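{- Let $n$ be a squarefree positive integer such that every prime divisor of $n$ is at least $7$ and let $p'$ be a prime divisor of $n$. Suppose $\Omega(n)\neq 2$. Then the $C$-extremal sequences for $L(n;p')$ are the same as the $C$-extremal sequences for $U(n)$; that is, a sequence in $\mathbb{Z}_n$ is a $C$-extremal sequence for $L(n;p')$ if and only if it is a $C$-extremal sequence for $U(n)$.
   Context: $\mathbb{Z}_n$ denotes the ring $\mathbb{Z}/n\mathbb{Z}$ and $U(n)$ its group of units. For odd $n$ and $x\in U(n)$, $\left(\frac{x}{n}\right)$ denotes the Jacobi symbol. For a prime divisor $p$ of $n$, $L(n;p)=\{a\in U(n):\left(\frac{a}{n}\right)=\left(\frac{a}{p}\right)\}$. For squarefree $n$, $\Omega(n)$ is the number of prime divisors of $n$. For $A\subseteq\mathbb{Z}_n$, a (nonempty, finite) sequence $(y_1,\ldots,y_k)$ in $\mathbb{Z}_n$ is an $A$-weighted zero-sum sequence if there exist $a_1,\ldots,a_k\in A$ with $a_1y_1+\cdots+a_ky_k=0$. The constant $C_A(n)$ is the least positive integer $k$ such that every sequence of length $k$ in $\mathbb{Z}_n$ has a (nonempty) subsequence of consecutive terms that is an $A$-weighted zero-sum sequence. If $0\notin A$, a $C$-extremal sequence for $A$ is a sequence in $\mathbb{Z}_n$ of length $C_A(n)-1$ which has no $A$-weighted zero-sum subsequence of consecutive terms. -}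

module Defs where

open import Algebra.Definitions using (Invertible)
open import Data.Fin.Base using (Fin; toℕ)
open import Data.Fin.Properties using (any?)
open import Data.Integer.Base as ℤ using (ℤ; 0ℤ; 1ℤ; -1ℤ)
open import Data.List.Base using (List; []; length; map; foldr; zipWith)
open import Data.List.Relation.Binary.Infix.Heterogeneous using (Infix)
open import Data.List.Relation.Unary.All using (All)
open import Data.Nat.Base using (ℕ; suc; _+_; _*_; _≤_; _<_; ∣_-_∣; NonZero)
open import Data.Nat.Divisibility using (_∣_; _∣?_)
open import Data.Nat.DivMod using (_mod_)
open import Data.Nat.Primality.Factorisation using (factors; factorise)
open import Data.Product.Base using (∃; _×_)
open import Level using (0ℓ)
open import Relation.Binary.PropositionalEquality.Core using (_≡_; _≢_)
open import Relation.Nullary using (¬_; Dec; yes; no)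
open import Relation.Unary using (Pred; _∈_)

SquareFree : ℕ → Set
SquareFree n = ∀ d → d * d ∣ n → d ≡ 1

-- Prime factors are counted with multiplicity; for squarefree n this is the
-- number of prime divisors of n.
Ω : (n : ℕ) .{{_ : NonZero n}} → ℕ
Ω n = length (factors (factorise n))

-- ∣_-_∣ is the distance on ℕ, so the condition reads x² ≡ a (mod p).
IsSquareMod : ℕ → ℕ → Set
IsSquareMod a p = ∃ λ (x : Fin p) → p ∣ ∣ toℕ x * toℕ x - a ∣

isSquareMod? : ∀ a p → Dec (IsSquareMod a p)
isSquareMod? a p = any? λ x → p ∣? ∣ toℕ x * toℕ x - a ∣

-- Meaningful for p an odd prime.
legendre : ℕ → ℕ → ℤ
legendre a p with p ∣? a | isSquareMod? a p
... | yes _ | _     = 0ℤ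
... | no  _ | yes _ = 1ℤ
... | no  _ | no  _ = -1ℤ

-- Meaningful for n odd.
jacobi : ℕ → (n : ℕ) .{{_ : NonZero n}} → ℤ
jacobi a n = foldr ℤ._*_ 1ℤ (map (legendre a) (factors (factorise n)))

-- The ring ℤ/nℤ, an element being represented by its residue in {0,…,n-1}.
ℤ/ : ℕ → Set
ℤ/ n = Fin n

module _ {n : ℕ} .{{_ : NonZero n}} where

  infixl 6 _⊕_
  infixl 7 _⊗_

  _⊕_ _⊗_ : ℤ/ n → ℤ/ n → ℤ/ n
  x ⊕ y = (toℕ x + toℕ y) mod n
  x ⊗ y = (toℕ x * toℕ y) mod n

  𝟘 𝟙 : ℤ/ n
  𝟘 = 0 mod n
  𝟙 = 1 mod n

  Σ⊕ : List (ℤ/ n) → ℤ/ n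
  Σ⊕ = foldr _⊕_ 𝟘

U : (n : ℕ) .{{_ : NonZero n}} → Pred (ℤ/ n) 0ℓ
U n x = Invertible _≡_ 𝟙 _⊗_ x

L : (n : ℕ) .{{_ : NonZero n}} → ℕ → Pred (ℤ/ n) 0ℓ
L n p a = a ∈ U n × jacobi (toℕ a) n ≡ legendre (toℕ a) p

module _ {n : ℕ} .{{_ : NonZero n}} (A : Pred (ℤ/ n) 0ℓ) where

  WeightedZeroSum : List (ℤ/ n) → Set
  WeightedZeroSum ys = ys ≢ [] ×
    ∃ λ as → length as ≡ length ys × All A as × Σ⊕ (zipWith _⊗_ as ys) ≡ 𝟘

  HasConsecutiveZeroSum : List (ℤ/ n) → Set
  HasConsecutiveZeroSum S = ∃ λ T → Infix _≡_ T S × WeightedZeroSum T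

  EveryHasConsecutiveZeroSum : ℕ → Set
  EveryHasConsecutiveZeroSum k = ∀ S → length S ≡ k → HasConsecutiveZeroSum S

  -- k = C_A(n).  The constant is given by its graph because for arbitrary A
  -- (for instance A empty) no such k need exist.
  IsC : ℕ → Set
  IsC k = 0 < k × EveryHasConsecutiveZeroSum k ×
    (∀ j → 0 < j → EveryHasConsecutiveZeroSum j → k ≤ j)

  -- The length of S is C_A(n) - 1.  The notion is meant for A not containing 0.
  CExtremal : List (ℤ/ n) → Set
  CExtremal S = IsC (suc (length S)) × ¬ HasConsecutiveZeroSum S

{-# OPTIONS --safe #-}

-- A sequence T is U(n)-weighted zero-sum only if no prime q ∣ n has exactly one
-- term of T nonzero mod q.  Conversely such a "good" T has weights in L(n;p′):
-- modulo a prime q ≥ 7 the quadratic characters of the weights can be prescribed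
-- freely unless T has exactly two terms nonzero mod q, when only the product of
-- the two characters at these terms is determined.  Hence characters whose product
-- over the primes q ≠ p′ is 1 exist, unless all these q share the same pair of
-- nonzero terms.  When n has at least three prime divisors, a sequence of length
-- 2^Ω(n) - 1 is too long for all of its good segments to be exceptional in this
-- way.  As C_{U(n)} ≥ 2^Ω(n), the two weight sets have the same extremal sequences.
module Submission where

open import Defs
open import Data.Fin.Base as Fin using (Fin; zero; suc; toℕ; fromℕ<)
import Data.Fin.Properties as Fin
open import Data.Integer.Base as ℤ using (ℤ; +_; 0ℤ; 1ℤ; -1ℤ; -_; _+_; _*_; _-_)
import Data.Integer.DivMod as ℤ
open import Data.Integer.Divisibility.Signed as ℤ using (divides)
import Data.Integer.Properties as ℤ
open import Data.Integer.Tactic.RingSolver using (solve-∀)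
open import Data.List.Base
  using (List; []; _∷_; _++_; length; lookup; filter; foldr; map; zipWith; tabulate; take)
open import Data.List.Membership.Propositional using (_∈_; find)
open import Data.List.Membership.Propositional.Properties using (∈-∃++)
open import Data.List.Properties using (filter-accept; filter-reject; length-++; length-take; length-tabulate)
open import Data.List.Relation.Binary.Infix.Heterogeneous using (Infix; here; there; _++ⁱ_; _ⁱ++_)
import Data.List.Relation.Binary.Infix.Heterogeneous.Properties as Infix
open import Data.List.Relation.Binary.Permutation.Propositional using (_↭_)
open import Data.List.Relation.Binary.Permutation.Propositional.Properties using (shift; All-resp-↭; ↭-length)
import Data.List.Relation.Binary.Pointwise as Pointwise
open import Data.List.Relation.Binary.Prefix.Heterogeneous using (Prefix; []; _∷_)
open import Data.List.Relation.Unary.All as All using (All; []; _∷_)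
import Data.List.Relation.Unary.All.Properties as All
open import Data.List.Relation.Unary.Any as Any using (here; there; any?)
import Data.List.Relation.Unary.Any.Properties as Any
open import Data.Nat.Base as ℕ using (ℕ; zero; suc; _^_; _≤_; _<_; NonZero; s≤s; z≤n; s≤s⁻¹)
import Data.Nat.Coprimality as ℕ
open import Data.Nat.DivMod using (_mod_)
import Data.Nat.DivMod as ℕ
open import Data.Nat.Divisibility as ℕ using (_∣_)
import Data.Nat.GCD as ℕ
open import Data.Nat.ListAction using (product)
open import Data.Nat.ListAction.Properties using (product-↭; ∈⇒∣product)
open import Data.Nat.Primality
  using (Prime; euclidsLemma; prime⇒nonZero; prime⇒irreducible; ¬prime[1])
open import Data.Nat.Primality.Factorisation
  using (PrimeFactorisation; factors; factorise; factorisationHasAllPrimeFactors)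
import Data.Nat.Properties as ℕ
open import Data.Product.Base using (∃; ∃₂; _×_; _,_; proj₁; proj₂)
open import Data.Sign.Base as Sign using (Sign)
import Data.Sign.Properties as Sign
open import Data.Sum.Base as Sum using (_⊎_; inj₁; inj₂; [_,_]′)
open import Data.Unit.Base using (⊤)
import Data.Vec.Functional as Vector
open import Function.Base using (_∘_; id; case_of_)
open import Function.Bundles using (_⇔_; mk⇔)
open import Level using (0ℓ)
open import Relation.Binary.Bundles using (Setoid)
open import Relation.Binary.PropositionalEquality
  using (_≡_; _≢_; refl; sym; trans; cong; cong₂; subst; module ≡-Reasoning)
import Relation.Binary.Reasoning.Setoid as SetoidReasoning
open import Relation.Nullary using (¬_; Dec; yes; no; contradiction)
open import Relation.Nullary.Decidable using (map′; ¬?; decidable-stable)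
open import Relation.Unary using (Pred; Decidable)

-- Congruences

-- In (a/n) = (a/p′) the factor at p′ cancels: there a weight need only be a unit, while its
-- characters at the other primes must multiply to 1. The obstacle is an exceptional segment T,
-- which may have weights in U(n) but none in L(n;p′). It is not repaired but exploited. T has two
-- nonzero terms modulo each q ≠ p′, and counts only grow with the segment, so no such q spoils a
-- segment containing T. Hence the whole sequence is good, or else p′ spoils it and T lies on one
-- side of the single term nonzero modulo p′, a side that is then good. If this larger segment is
-- exceptional too but long enough, it contains terms vanishing modulo every q ≠ p′. One of them
-- that vanishes modulo p′ as well, or two adjacent ones that do not, form a segment on which only
-- p′ matters, so weights in L(n;p′) exist. If the side of T is too short, the other side has at
-- least 2^(Ω(n)-1) terms, and a good segment is found there by halving. The length estimates rest
-- on 4 ≤ 2^(Ω(n)-1).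

bézout : ∀ {m n} → ℕ.Coprime m n → ∃₂ λ u v → u * + m + v * + n ≡ 1ℤ
bézout {m} {n} c = combine (ℕ.coprime-Bézout c)
  where
  cancel : ∀ y k → 1ℤ + y * k + (- y) * k ≡ 1ℤ
  cancel = solve-∀
  cancel′ : ∀ x k → (- x) * k + (1ℤ + x * k) ≡ 1ℤ
  cancel′ = solve-∀
  lift : ∀ a b k l → 1 ℕ.+ a ℕ.* k ≡ b ℕ.* l → 1ℤ + + a * + k ≡ + b * + l
  lift a b k l eq = trans (cong (λ z → 1ℤ + z) (sym (ℤ.pos-* a k))) (trans (cong +_ eq) (ℤ.pos-* b l))
  combine : ℕ.Bézout.Identity 1 m n → ∃₂ λ u v → u * + m + v * + n ≡ 1ℤ
  combine (ℕ.Bézout.+- x y eq) = + x , - + y ,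
    trans (cong (λ z → z + (- + y) * + n) (sym (lift y x n m eq))) (cancel (+ y) (+ n))
  combine (ℕ.Bézout.-+ x y eq) = - + x , + y ,
    trans (cong (λ z → (- + x) * + m + z) (sym (lift x y m n eq))) (cancel′ (+ x) (+ m))

∣m-n∣≡∣m-n∣ℤ : ∀ m n → ℕ.∣ m - n ∣ ≡ ℤ.∣ + m - + n ∣
∣m-n∣≡∣m-n∣ℤ m n with ℕ.≤-total m n
... | inj₁ m≤n = trans (ℕ.m≤n⇒∣m-n∣≡n∸m m≤n)
      (sym (trans (cong ℤ.∣_∣ (ℤ.m-n≡m⊖n m n)) (ℤ.∣⊖∣-≤ m≤n)))
... | inj₂ n≤m = trans (trans (ℕ.∣-∣-comm m n) (ℕ.m≤n⇒∣m-n∣≡n∸m n≤m))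
      (sym (trans (cong ℤ.∣_∣ (ℤ.m-n≡m⊖n m n)) (trans (ℤ.∣m⊖n∣≡∣n⊖m∣ m n) (ℤ.∣⊖∣-≤ n≤m))))

module Mod (m : ℕ) where

  infix 4 _≈_

  -- A record instead of bare divisibility, so that `a` and `b` can be inferred from a congruence;
  -- the difference `a - b` does not determine them.
  record _≈_ (a b : ℤ) : Set where
    constructor congruent
    field difference : + m ℤ.∣ a - b

  open _≈_ public

  ≡⇒≈ : ∀ {a b} → a ≡ b → a ≈ b
  ≡⇒≈ {a} refl = congruent (divides 0ℤ (ℤ.+-inverseʳ a))

  ≈-refl : ∀ {a} → a ≈ a
  ≈-refl = ≡⇒≈ refl

  ≈-sym : ∀ {a b} → a ≈ b → b ≈ a
  ≈-sym {a} {b} (congruent d) = congruent (subst (+ m ℤ.∣_) (lemma a b) (ℤ.∣m⇒∣-m d))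
    where
    lemma : ∀ a b → - (a - b) ≡ b - a
    lemma = solve-∀

  ≈-trans : ∀ {a b c} → a ≈ b → b ≈ c → a ≈ c
  ≈-trans {a} {b} {c} (congruent d) (congruent e) =
    congruent (subst (+ m ℤ.∣_) (lemma a b c) (ℤ.∣m∣n⇒∣m+n d e))
    where
    lemma : ∀ a b c → (a - b) + (b - c) ≡ a - c
    lemma = solve-∀

  +-cong : ∀ {a b c d} → a ≈ b → c ≈ d → a + c ≈ b + d
  +-cong {a} {b} {c} {d} (congruent p) (congruent q) =
    congruent (subst (+ m ℤ.∣_) (lemma a b c d) (ℤ.∣m∣n⇒∣m+n p q))
    where
    lemma : ∀ a b c d → (a - b) + (c - d) ≡ (a + c) - (b + d)
    lemma = solve-∀

  *-cong : ∀ {a b c d} → a ≈ b → c ≈ d → a * c ≈ b * d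
  *-cong {a} {b} {c} {d} (congruent p) (congruent q) =
    congruent (subst (+ m ℤ.∣_) (lemma a b c d)
      (ℤ.∣m∣n⇒∣m+n (ℤ.∣n⇒∣m*n c p) (ℤ.∣n⇒∣m*n b q)))
    where
    lemma : ∀ a b c d → c * (a - b) + b * (c - d) ≡ a * c - b * d
    lemma = solve-∀

  *-congˡ : ∀ {a b} c → a ≈ b → c * a ≈ c * b
  *-congˡ c = *-cong (≈-refl {c})

  *-congʳ : ∀ {a b} c → a ≈ b → a * c ≈ b * c
  *-congʳ c p = *-cong p (≈-refl {c})

  square-cong : ∀ a b → a ≈ b → a * a ≈ b * b
  square-cong a b p = *-cong {a} {b} {a} {b} p p

  neg-cong : ∀ {a b} → a ≈ b → - a ≈ - b
  neg-cong {a} {b} (congruent d) = congruent (subst (+ m ℤ.∣_) (lemma a b) (ℤ.∣m⇒∣-m d))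
    where
    lemma : ∀ a b → - (a - b) ≡ - a - (- b)
    lemma = solve-∀

  ∣⇒≈0 : ∀ {a} → + m ℤ.∣ a → a ≈ 0ℤ
  ∣⇒≈0 {a} d = congruent (subst (+ m ℤ.∣_) (sym (ℤ.+-identityʳ a)) d)

  ≈0⇒∣ : ∀ {a} → a ≈ 0ℤ → + m ℤ.∣ a
  ≈0⇒∣ {a} (congruent d) = subst (+ m ℤ.∣_) (ℤ.+-identityʳ a) d

  ≈-by-multiple : ∀ {a b} c d → d ≈ 0ℤ → a - b ≡ c * d → a ≈ b
  ≈-by-multiple c d d≈0 eq = congruent (subst (+ m ℤ.∣_) (sym eq) (ℤ.∣n⇒∣m*n c (≈0⇒∣ d≈0)))

  -≈0 : ∀ {a b} → a ≈ b → a - b ≈ 0ℤ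
  -≈0 = ∣⇒≈0 ∘ difference

  -≈0⁻¹ : ∀ {a b} → a - b ≈ 0ℤ → a ≈ b
  -≈0⁻¹ = congruent ∘ ≈0⇒∣

  infix 4 _≈?_
  _≈?_ : ∀ a b → Dec (a ≈ b)
  a ≈? b = map′ congruent difference (+ m ℤ.∣? (a - b))

  setoid : Setoid _ _
  setoid = record
    { _≈_ = _≈_
    ; isEquivalence = record { refl = ≈-refl ; sym = ≈-sym ; trans = ≈-trans } }

  module ≈-Reasoning = SetoidReasoning setoid

  ℕ∣⇒≈0 : ∀ {a} → m ℕ.∣ a → + a ≈ 0ℤ
  ℕ∣⇒≈0 = ∣⇒≈0 ∘ ℤ.∣ᵤ⇒∣

  ≈0⇒ℕ∣ : ∀ {a} → + a ≈ 0ℤ → m ℕ.∣ a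
  ≈0⇒ℕ∣ = ℤ.∣⇒∣ᵤ ∘ ≈0⇒∣

  ≈⇒∣dist : ∀ {a b} → + a ≈ + b → m ℕ.∣ ℕ.∣ a - b ∣
  ≈⇒∣dist {a} {b} p = subst (m ℕ.∣_) (sym (∣m-n∣≡∣m-n∣ℤ a b)) (ℤ.∣⇒∣ᵤ (difference p))

  ∣dist⇒≈ : ∀ {a b} → m ℕ.∣ ℕ.∣ a - b ∣ → + a ≈ + b
  ∣dist⇒≈ {a} {b} p = congruent (ℤ.∣ᵤ⇒∣ (subst (m ℕ.∣_) (∣m-n∣≡∣m-n∣ℤ a b) p))

  ≈⇒≡ : ∀ {a b} → a < m → b < m → + a ≈ + b → a ≡ b
  ≈⇒≡ {a} {b} a<m b<m p with ≈⇒∣dist p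
  ... | m∣d with ℕ.∣ a - b ∣ in eq
  ...   | zero  = ℕ.∣m-n∣≡0⇒m≡n eq
  ...   | suc k = contradiction (ℕ.∣⇒≤ m∣d) (ℕ.<⇒≱ (subst (_< m) eq
                     (ℕ.≤-<-trans (ℕ.∣m-n∣≤m⊔n a b) (ℕ.⊔-pres-<m a<m b<m))))

  -- Being nonzero amounts to invertibility only for a prime modulus, the case in which this notion
  -- is applied.
  Unit : ℤ → Set
  Unit a = ¬ a ≈ 0ℤ

  unit-≈ : ∀ {a b} → a ≈ b → Unit a → Unit b
  unit-≈ a≈b ua b≈0 = ua (≈-trans a≈b b≈0)

  IsSquare : ℤ → Set
  IsSquare a = ∃ λ x → x * x ≈ a

  isSquare-≈ : ∀ {a b} → a ≈ b → IsSquare a → IsSquare b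
  isSquare-≈ a≈b (x , p) = x , ≈-trans p a≈b

  -- The quadratic character as a relation. Its values lie in the group of signs because zero
  -- residues have none.
  HasSign : Sign → ℤ → Set
  HasSign Sign.+ a = Unit a × IsSquare a
  HasSign Sign.- a = Unit a × ¬ IsSquare a

  hasSign⇒unit : ∀ s {a} → HasSign s a → Unit a
  hasSign⇒unit Sign.+ = proj₁
  hasSign⇒unit Sign.- = proj₁

  sign-≈ : ∀ s {a b} → a ≈ b → HasSign s a → HasSign s b
  sign-≈ Sign.+ a≈b (u , sq) = unit-≈ a≈b u , isSquare-≈ a≈b sq
  sign-≈ Sign.- a≈b (u , ¬sq) = unit-≈ a≈b u , ¬sq ∘ isSquare-≈ (≈-sym a≈b)

  module _ .{{_ : NonZero m}} where

    %ℕ-≈ : ∀ a → + (a ℤ.%ℕ m) ≈ a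
    %ℕ-≈ a = ≈-sym (congruent (divides (a ℤ./ℕ m)
      (trans (cong (λ z → z - + (a ℤ.%ℕ m)) (ℤ.a≡a%ℕn+[a/ℕn]*n a m)) (lemma (+ (a ℤ.%ℕ m)) _))))
      where
      lemma : ∀ r s → r + s - r ≡ s
      lemma = solve-∀

    residue : ℤ → Fin m
    residue a = fromℕ< (ℤ.n%ℕd<d a m)

    residue-≈ : ∀ a → + toℕ (residue a) ≈ a
    residue-≈ a = ≈-trans (≡⇒≈ (cong +_ (Fin.toℕ-fromℕ< (ℤ.n%ℕd<d a m)))) (%ℕ-≈ a)

    mod-≈ : ∀ a → + toℕ (a ℕ.mod m) ≈ + a
    mod-≈ a = ≈-trans (≡⇒≈ (cong +_ (Fin.toℕ-fromℕ< (ℕ.m%n<n a m)))) (%ℕ-≈ (+ a))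

    toℕ-injective-≈ : ∀ {x y : Fin m} → + toℕ x ≈ + toℕ y → x ≡ y
    toℕ-injective-≈ {x} {y} p = Fin.toℕ-injective (≈⇒≡ (Fin.toℕ<n x) (Fin.toℕ<n y) p)

    residue-injective : ∀ a b → residue a ≡ residue b → a ≈ b
    residue-injective a b eq = ≈-trans (≈-sym (residue-≈ a)) (≈-trans (≡⇒≈ (cong (λ x → + toℕ x) eq)) (residue-≈ b))

-- Squares modulo a prime q ≥ 7

module PrimeField (q : ℕ) (q-prime : Prime q) (7≤q : 7 ≤ q) where

  open Mod q public

  instance
    q≢0 : NonZero q
    q≢0 = prime⇒nonZero q-prime

  euclid : ∀ a b → a * b ≈ 0ℤ → a ≈ 0ℤ ⊎ b ≈ 0ℤ
  euclid a b p with euclidsLemma ℤ.∣ a ∣ ℤ.∣ b ∣ q-prime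
                      (subst (q ℕ.∣_) (ℤ.abs-* a b) (ℤ.∣⇒∣ᵤ (≈0⇒∣ p)))
  ... | inj₁ d = inj₁ (∣⇒≈0 (ℤ.∣ᵤ⇒∣ d))
  ... | inj₂ d = inj₂ (∣⇒≈0 (ℤ.∣ᵤ⇒∣ d))

  unit-* : ∀ {a b} → Unit a → Unit b → Unit (a * b)
  unit-* {a} {b} ua ub p = [ ua , ub ]′ (euclid a b p)

  unit-*⁻ˡ : ∀ {a b} → Unit (a * b) → Unit a
  unit-*⁻ˡ {b = b} u p = u (≈-trans (*-congʳ b p) (≡⇒≈ (ℤ.*-zeroˡ b)))

  unit-neg : ∀ {a} → Unit a → Unit (- a)
  unit-neg {a} ua p = ua (≈-trans (≡⇒≈ (sym (ℤ.neg-involutive a))) (neg-cong p))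

  unit-small : ∀ {k} → 0 < k → k < q → Unit (+ k)
  unit-small 0<k k<q p = ℕ.<⇒≢ 0<k (sym (≈⇒≡ k<q (ℕ.<-trans 0<k k<q) p))

  unit-literal : ∀ k → .{{NonZero k}} → k < 7 → Unit (+ k)
  unit-literal k k<7 = unit-small (ℕ.>-nonZero⁻¹ k) (ℕ.<-≤-trans k<7 7≤q)

  unit-1 : Unit 1ℤ
  unit-1 = unit-literal 1 (ℕ.s<s ℕ.z<s)

  inverse : ∀ {a} → Unit a → ∃ λ b → a * b ≈ 1ℤ
  inverse {a} ua with a ℤ.%ℕ q in eq | %ℕ-≈ a | ℤ.n%ℕd<d a q
  ... | zero  | r≈a | _   = contradiction (≈-sym r≈a) ua
  ... | suc r | r≈a | r<q with bézout (ℕ.prime⇒coprime q-prime r<q)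
  ...   | u , v , b = v , ≈-trans (*-congʳ v (≈-sym r≈a))
          (congruent (divides (- u) (trans (cong (λ z → + suc r * v - z) (sym b)) (lemma (+ suc r) u v (+ q)))))
    where
    lemma : ∀ r u v k → r * v - (u * k + v * r) ≡ - u * k
    lemma = solve-∀

  *-cancelˡ : ∀ {a b} c → Unit c → c * a ≈ c * b → a ≈ b
  *-cancelˡ {a} {b} c uc p =
    -≈0⁻¹ ([ (λ c≈0 → contradiction c≈0 uc) , id ]′
      (euclid c (a - b) (≈-trans (≡⇒≈ (lemma a b c)) (-≈0 p))))
    where
    lemma : ∀ a b c → c * (a - b) ≡ c * a - c * b
    lemma = solve-∀

  IsSquareMod⇒IsSquare : ∀ a → IsSquareMod a q → IsSquare (+ a)
  IsSquareMod⇒IsSquare a (x , d) = + toℕ x , ≈-trans (≡⇒≈ (sym (ℤ.pos-* (toℕ x) (toℕ x)))) (∣dist⇒≈ d)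

  IsSquare⇒IsSquareMod : ∀ a → IsSquare (+ a) → IsSquareMod a q
  IsSquare⇒IsSquareMod a (x , p) = residue x , ≈⇒∣dist
    (≈-trans (≡⇒≈ (ℤ.pos-* (toℕ (residue x)) (toℕ (residue x))))
      (≈-trans (square-cong (+ toℕ (residue x)) x (residue-≈ x)) p))

  isSquareℕ? : ∀ a → Dec (IsSquare (+ a))
  isSquareℕ? a = map′ (IsSquareMod⇒IsSquare a) (IsSquare⇒IsSquareMod a) (isSquareMod? a q)

  isSquare? : ∀ a → Dec (IsSquare a)
  isSquare? a = map′ (isSquare-≈ (%ℕ-≈ a)) (isSquare-≈ (≈-sym (%ℕ-≈ a))) (isSquareℕ? (a ℤ.%ℕ q))

  ±roots : ∀ a b → a * a ≈ b * b → a ≈ b ⊎ a + b ≈ 0ℤ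
  ±roots a b p with euclid (a - b) (a + b) (≈-trans (≡⇒≈ (lemma a b)) (-≈0 p))
    where
    lemma : ∀ a b → (a - b) * (a + b) ≡ a * a - b * b
    lemma = solve-∀
  ... | inj₁ d = inj₁ (-≈0⁻¹ d)
  ... | inj₂ d = inj₂ d

  double : ∀ {a} → Unit a → Unit (a + a)
  double {a} ua p = unit-* (unit-literal 2 (ℕ.s<s (ℕ.s<s ℕ.z<s))) ua (≈-trans (≡⇒≈ (lemma a)) p)
    where
    lemma : ∀ a → + 2 * a ≡ a + a
    lemma a = trans (ℤ.*-distribʳ-+ a 1ℤ 1ℤ) (cong₂ _+_ (ℤ.*-identityˡ a) (ℤ.*-identityˡ a))

  -- If every residue i had a root r i, then r together with the second root
  -- of 1 would inject q + 1 elements into the q residues.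
  ¬all-squares : ¬ (∀ (i : Fin q) → IsSquare (+ toℕ i))
  ¬all-squares sq = ℕ.1+n≰n (Fin.injective⇒≤ {f = f} f-injective)
    where
    one : Fin q
    one = residue 1ℤ
    r : Fin q → ℤ
    r i = proj₁ (sq i)
    r1²≈1 : r one * r one ≈ 1ℤ
    r1²≈1 = ≈-trans (proj₂ (sq one)) (residue-≈ 1ℤ)
    r1-unit : Unit (r one)
    r1-unit = unit-*⁻ˡ (unit-≈ (≈-sym r1²≈1) unit-1)
    f : Fin (suc q) → Fin q
    f zero    = residue (- r one)
    f (suc i) = residue (r i)
    -- Squaring `- r one ≈ r i` forces `i ≡ one`; then `r one` would be its own negative, impossible
    -- for a unit modulo an odd prime.
    clash : ∀ i → ¬ (- r one ≈ r i)
    clash i p = double r1-unit (≈-trans (+-cong (≈-refl {r one}) r1≈-r1) (≡⇒≈ (ℤ.+-inverseʳ (r one))))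
      where
      lemma : ∀ a → (- a) * (- a) ≡ a * a
      lemma = solve-∀
      i≡1 : i ≡ one
      i≡1 = toℕ-injective-≈ (≈-trans (≈-sym (proj₂ (sq i))) (≈-trans (square-cong (r i) (- r one) (≈-sym p))
              (≈-trans (≡⇒≈ (lemma (r one))) (proj₂ (sq one)))))
      r1≈-r1 : r one ≈ - r one
      r1≈-r1 = ≈-sym (subst (λ j → - r one ≈ r j) i≡1 p)
    f-injective : ∀ {i j} → f i ≡ f j → i ≡ j
    f-injective {zero}  {zero}  eq = refl
    f-injective {zero}  {suc j} eq = contradiction (residue-injective (- r one) (r j) eq) (clash j)
    f-injective {suc i} {zero}  eq = contradiction (residue-injective (- r one) (r i) (sym eq)) (clash i)
    f-injective {suc i} {suc j} eq = cong suc (toℕ-injective-≈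
      (≈-trans (≈-sym (proj₂ (sq i))) (≈-trans (square-cong (r i) (r j) (residue-injective (r i) (r j) eq)) (proj₂ (sq j)))))

  -- As 0 and 1 are squares, the least nonsquare residue is at least 2, so its predecessor `g` is a
  -- nonzero square. Such a neighbouring pair yields explicit sums of mixed character later on.
  least-nonsquare : ∃ λ g → Unit (+ g) × IsSquare (+ g) × ¬ IsSquare (+ suc g)
  least-nonsquare with Fin.¬∀⟶∃¬-smallest q (λ i → IsSquare (+ toℕ i)) (λ i → isSquareℕ? (toℕ i)) ¬all-squares
  ... | i , ¬sq , below = go (toℕ i) refl
    where
    go : ∀ k → toℕ i ≡ k → ∃ λ g → Unit (+ g) × IsSquare (+ g) × ¬ IsSquare (+ suc g)
    go 0 eq = contradiction (0ℤ , ≡⇒≈ (cong +_ (sym eq))) ¬sq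
    go 1 eq = contradiction (1ℤ , ≡⇒≈ (cong +_ (sym eq))) ¬sq
    go (suc (suc g)) eq = suc g , unit-small ℕ.z<s (ℕ.<-trans g<i (Fin.toℕ<n i))
      , subst (λ k → IsSquare (+ k)) (trans (Fin.toℕ-inject (fromℕ< g<i)) (Fin.toℕ-fromℕ< g<i)) (below (fromℕ< g<i))
      , subst (λ k → ¬ IsSquare (+ k)) eq ¬sq
      where
      g<i : suc g < toℕ i
      g<i = ℕ.≤-reflexive (sym eq)

  odd : ∃ λ h → q ≡ 1 ℕ.+ h ℕ.* 2
  odd with q ℕ.% 2 in eq | ℕ.m≡m%n+[m/n]*n q 2 | ℕ.m%n<n q 2
  ... | 0 | _ | _ = case prime⇒irreducible q-prime (ℕ.m%n≡0⇒n∣m q 2 eq) of λ where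
        (inj₁ ())
        (inj₂ 2≡q) → contradiction (subst (7 ≤_) (sym 2≡q) 7≤q) λ { (s≤s (s≤s ())) }
  ... | 1 | e | _ = q ℕ./ 2 , e
  ... | suc (suc _) | _ | s≤s (s≤s ())

  ±roots-scaled : ∀ c a b → Unit c → c * (a * a) ≈ c * (b * b) → a ≈ b ⊎ a + b ≈ 0ℤ
  ±roots-scaled c a b uc p = ±roots a b (*-cancelˡ {a * a} {b * b} c uc p)

  -- From r = s (y/x)² follows r s = (s y/x)².
  ratio-square : ∀ r s x y → Unit x → r * (x * x) ≈ s * (y * y) → IsSquare (r * s)
  ratio-square r s x y ux p with inverse ux
  ... | x⁻¹ , inv = s * y * x⁻¹ , (begin
        s * y * x⁻¹ * (s * y * x⁻¹)          ≡⟨ lemma₁ s y x⁻¹ ⟩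
        s * (x⁻¹ * x⁻¹) * (s * (y * y))      ≈⟨ *-congˡ (s * (x⁻¹ * x⁻¹)) p ⟨
        s * (x⁻¹ * x⁻¹) * (r * (x * x))      ≡⟨ lemma₂ r s x x⁻¹ ⟩
        r * s * ((x * x⁻¹) * (x * x⁻¹))      ≈⟨ *-congˡ (r * s) (square-cong (x * x⁻¹) 1ℤ inv) ⟩
        r * s * 1ℤ                           ≡⟨ ℤ.*-identityʳ (r * s) ⟩
        r * s                                ∎)
    where
    open ≈-Reasoning
    lemma₁ : ∀ r y z → r * y * z * (r * y * z) ≡ r * (z * z) * (r * (y * y))
    lemma₁ = solve-∀
    lemma₂ : ∀ r s x z → s * (z * z) * (r * (x * x)) ≡ r * s * ((x * z) * (x * z))
    lemma₂ = solve-∀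

  -- Otherwise the cosets of 1, g and k modulo the squares are distinct, and
  -- since x ↦ x² is injective on {1,…,h} there are 3h > q residues.
  ¬three-cosets : ∀ h → q ≡ 1 ℕ.+ h ℕ.* 2 → ∀ g k → Unit g → Unit k →
    ¬ IsSquare g → ¬ IsSquare k → ¬ ¬ IsSquare (g * k)
  ¬three-cosets h q≡1+2h g k ug uk ¬g ¬k ¬gk = contradiction (Fin.injective⇒≤ {f = F} F-injective) (ℕ.<⇒≱ q<3h)
    where
    1*≈ : ∀ {a} → ¬ IsSquare a → ¬ IsSquare (1ℤ * a)
    1*≈ {a} ¬a = ¬a ∘ isSquare-≈ (≡⇒≈ (ℤ.*-identityˡ a))
    *1≈ : ∀ {a} → ¬ IsSquare a → ¬ IsSquare (a * 1ℤ)
    *1≈ {a} ¬a = ¬a ∘ isSquare-≈ (≡⇒≈ (ℤ.*-identityʳ a))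
    rep : Fin 3 → ℤ
    rep zero = 1ℤ
    rep (suc zero) = g
    rep (suc (suc zero)) = k
    rep-unit : ∀ i → Unit (rep i)
    rep-unit zero = unit-1
    rep-unit (suc zero) = ug
    rep-unit (suc (suc zero)) = uk
    separated : ∀ i j → i ≢ j → ¬ IsSquare (rep i * rep j)
    separated zero zero i≢j = contradiction refl i≢j
    separated zero (suc zero) _ = 1*≈ ¬g
    separated zero (suc (suc zero)) _ = 1*≈ ¬k
    separated (suc zero) zero _ = *1≈ ¬g
    separated (suc zero) (suc zero) i≢j = contradiction refl i≢j
    separated (suc zero) (suc (suc zero)) _ = ¬gk
    separated (suc (suc zero)) zero _ = *1≈ ¬k
    separated (suc (suc zero)) (suc zero) _ = ¬gk ∘ isSquare-≈ (≡⇒≈ (ℤ.*-comm k g))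
    separated (suc (suc zero)) (suc (suc zero)) i≢j = contradiction refl i≢j
    val : Fin h → ℤ
    val x = + suc (toℕ x)
    h+h<q : h ℕ.+ h < q
    h+h<q = ℕ.≤-reflexive (trans (cong suc (trans (cong (h ℕ.+_) (sym (ℕ.+-identityʳ h))) (ℕ.*-comm 2 h))) (sym q≡1+2h))
    -- Two values from {1,...,h} add up to at most 2h = q - 1, so they are never opposite roots of
    -- the same square.
    val+val< : ∀ x y → suc (toℕ x) ℕ.+ suc (toℕ y) < q
    val+val< x y = ℕ.≤-<-trans (ℕ.+-mono-≤ (Fin.toℕ<n x) (Fin.toℕ<n y)) h+h<q
    val< : ∀ (x : Fin h) → suc (toℕ x) < q
    val< x = ℕ.≤-<-trans (ℕ.m≤m+n _ _) (val+val< x x)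
    val-unit : ∀ x → Unit (val x)
    val-unit x = unit-small ℕ.z<s (val< x)
    element : Fin 3 → Fin h → ℤ
    element i x = rep i * (val x * val x)
    same-coset : ∀ i x y → element i x ≈ element i y → x ≡ y
    same-coset i x y p =
      [ (λ d → Fin.toℕ-injective (ℕ.suc-injective (≈⇒≡ (val< x) (val< y) d)))
      , (λ d → contradiction d (unit-small ℕ.z<s (val+val< x y)))
      ]′ (±roots-scaled (rep i) (val x) (val y) (rep-unit i) p)
    F₂ : Fin 3 × Fin h → Fin q
    F₂ (i , x) = residue (element i x)
    F₂-injective : ∀ u v → F₂ u ≡ F₂ v → u ≡ v
    F₂-injective (i , x) (j , y) eq = conclude (i Fin.≟ j)
      where
      e : element i x ≈ element j y
      e = residue-injective (element i x) (element j y) eq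
      conclude : Dec (i ≡ j) → (i , x) ≡ (j , y)
      conclude (yes refl) = cong (i ,_) (same-coset i x y e)
      conclude (no i≢j) = contradiction (ratio-square (rep i) (rep j) (val x) (val y) (val-unit x) e) (separated i j i≢j)
    F : Fin (3 ℕ.* h) → Fin q
    F = F₂ ∘ Fin.remQuot {3} h
    F-injective : ∀ {u v} → F u ≡ F v → u ≡ v
    F-injective {u} {v} eq = trans (sym (Fin.combine-remQuot {3} h u))
      (trans (cong (λ p → Fin.combine (proj₁ p) (proj₂ p)) (F₂-injective (Fin.remQuot {3} h u) (Fin.remQuot {3} h v) eq))
        (Fin.combine-remQuot {3} h v))
    2≤ : ∀ k → 7 ≤ 1 ℕ.+ k ℕ.* 2 → 2 ≤ k
    2≤ 0 (s≤s ())
    2≤ 1 (s≤s (s≤s (s≤s ())))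
    2≤ (suc (suc k)) _ = s≤s (s≤s z≤n)
    2≤h : 2 ≤ h
    2≤h = 2≤ h (subst (7 ≤_) q≡1+2h 7≤q)
    -- 3h exceeds q = 1 + 2h as soon as h ≥ 2.
    q<3h : q < 3 ℕ.* h
    q<3h = subst (_< 3 ℕ.* h) (sym q≡1+2h)
      (ℕ.<-≤-trans (ℕ.+-monoˡ-< (h ℕ.* 2) 2≤h)
        (ℕ.≤-reflexive (cong (h ℕ.+_) (ℕ.*-comm h 2))))

  -- The count gives only a double negation. It can be removed since being a square is decided by a
  -- search over the residues.
  nonsquare-* : ∀ g k → Unit g → Unit k → ¬ IsSquare g → ¬ IsSquare k → IsSquare (g * k)
  nonsquare-* g k ug uk ¬g ¬k =
    decidable-stable (isSquare? (g * k)) (¬three-cosets (proj₁ odd) (proj₂ odd) g k ug uk ¬g ¬k)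

-- The quadratic character and sums of two elements of prescribed characters

module QuadraticCharacter (q : ℕ) (q-prime : Prime q) (7≤q : 7 ≤ q) where

  open PrimeField q q-prime 7≤q public

  sign-of : ∀ a → Unit a → ∃ λ s → HasSign s a
  sign-of a ua with isSquare? a
  ... | yes sq = Sign.+ , ua , sq
  ... | no ¬sq = Sign.- , ua , ¬sq

  sign-unique : ∀ s t {a} → HasSign s a → HasSign t a → s ≡ t
  sign-unique Sign.+ Sign.+ _ _ = refl
  sign-unique Sign.- Sign.- _ _ = refl
  sign-unique Sign.+ Sign.- (_ , sq) (_ , ¬sq) = contradiction sq ¬sq
  sign-unique Sign.- Sign.+ (_ , ¬sq) (_ , sq) = contradiction sq ¬sq

  square-* : ∀ a b → IsSquare a → IsSquare b → IsSquare (a * b)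
  square-* a b (x , p) (y , r) = x * y , ≈-trans (≡⇒≈ (lemma x y)) (*-cong p r)
    where
    lemma : ∀ x y → x * y * (x * y) ≡ (x * x) * (y * y)
    lemma = solve-∀

  square-nonsquare-* : ∀ a b → Unit a → IsSquare a → ¬ IsSquare b → ¬ IsSquare (a * b)
  square-nonsquare-* a b ua (x , x²≈a) ¬b (y , y²≈ab) = ¬b (y * x⁻¹ , (begin
      y * x⁻¹ * (y * x⁻¹)             ≡⟨ lemma₁ y x⁻¹ ⟩
      y * y * (x⁻¹ * x⁻¹)             ≈⟨ *-congʳ (x⁻¹ * x⁻¹) y²≈ab ⟩
      a * b * (x⁻¹ * x⁻¹)             ≈⟨ *-congʳ (x⁻¹ * x⁻¹) (*-congʳ b x²≈a) ⟨
      x * x * b * (x⁻¹ * x⁻¹)         ≡⟨ lemma₂ x b x⁻¹ ⟩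
      b * ((x * x⁻¹) * (x * x⁻¹))     ≈⟨ *-congˡ b (square-cong (x * x⁻¹) 1ℤ inv) ⟩
      b * 1ℤ                          ≡⟨ ℤ.*-identityʳ b ⟩
      b                               ∎))
    where
    open ≈-Reasoning
    ux : Unit x
    ux = unit-*⁻ˡ (unit-≈ (≈-sym x²≈a) ua)
    x⁻¹ = proj₁ (inverse ux)
    inv = proj₂ (inverse ux)
    lemma₁ : ∀ y z → y * z * (y * z) ≡ y * y * (z * z)
    lemma₁ = solve-∀
    lemma₂ : ∀ x b z → x * x * b * (z * z) ≡ b * ((x * z) * (x * z))
    lemma₂ = solve-∀

  sign-* : ∀ s t a b → HasSign s a → HasSign t b → HasSign (s Sign.* t) (a * b)
  sign-* Sign.+ Sign.+ a b (ua , sa) (ub , sb) = unit-* ua ub , square-* a b sa sb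
  sign-* Sign.+ Sign.- a b (ua , sa) (ub , sb) = unit-* ua ub , square-nonsquare-* a b ua sa sb
  sign-* Sign.- Sign.+ a b (ua , sa) (ub , sb) = unit-* ua ub ,
    square-nonsquare-* b a ub sb sa ∘ isSquare-≈ (≡⇒≈ (ℤ.*-comm a b))
  sign-* Sign.- Sign.- a b (ua , sa) (ub , sb) = unit-* ua ub , nonsquare-* a b ua ub sa sb

  sign-1 : HasSign Sign.+ 1ℤ
  sign-1 = unit-1 , 1ℤ , ≈-refl

  -- The characters of `a` and `b` multiply to that of 1, and signs are their own inverses.
  sign-inverse : ∀ s a b → HasSign s a → a * b ≈ 1ℤ → HasSign s b
  sign-inverse s a b sa inv = subst (λ r → HasSign r b) s′≡s sb
    where
    ub : Unit b
    ub b≈0 = unit-1 (≈-trans (≈-sym inv) (≈-trans (*-congˡ a b≈0) (≡⇒≈ (ℤ.*-zeroʳ a))))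
    s′ = proj₁ (sign-of b ub)
    sb = proj₂ (sign-of b ub)
    s′≡s : s′ ≡ s
    s′≡s = Sign.*-cancelˡ-≡ s s′ s (trans
      (sign-unique (s Sign.* s′) Sign.+ (sign-* s s′ a b sa sb) (sign-≈ Sign.+ (≈-sym inv) sign-1))
      (sym (Sign.s*s≡+ s)))

  nonsquare : ℤ
  nonsquare = + suc (proj₁ least-nonsquare)

  sign-nonsquare : HasSign Sign.- nonsquare
  sign-nonsquare = (λ p → ¬sq (0ℤ , ≈-sym p)) , ¬sq
    where ¬sq = proj₂ (proj₂ (proj₂ least-nonsquare))

  of-sign : ∀ s → ∃ λ a → HasSign s a
  of-sign Sign.+ = 1ℤ , sign-1
  of-sign Sign.- = nonsquare , sign-nonsquare

  SumOfSigns : Sign → Sign → Sign → Set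
  SumOfSigns s t u = ∃₂ λ a b → HasSign s a × HasSign t b × HasSign u (a + b)

  sumOfSigns-swap : ∀ s t u → SumOfSigns s t u → SumOfSigns t s u
  sumOfSigns-swap s t u (a , b , sa , tb , uc) = b , a , tb , sa , sign-≈ u (≡⇒≈ (ℤ.+-comm a b)) uc

  sumOfSigns-opposite : ∀ s t u → SumOfSigns s t u →
    SumOfSigns (Sign.opposite s) (Sign.opposite t) (Sign.opposite u)
  sumOfSigns-opposite s t u (a , b , sa , tb , uc) = g * a , g * b
    , sign-* Sign.- s g a sign-nonsquare sa
    , sign-* Sign.- t g b sign-nonsquare tb
    , sign-≈ (Sign.opposite u) (≡⇒≈ (ℤ.*-distribˡ-+ g a b)) (sign-* Sign.- u g (a + b) sign-nonsquare uc)
    where g = nonsquare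

  sign-literal² : ∀ k → .{{NonZero k}} → k < 7 → HasSign Sign.+ (+ (k ℕ.* k))
  sign-literal² k k<7 = sign-≈ Sign.+ (≡⇒≈ (sym (ℤ.pos-* k k)))
    (unit-* (unit-literal k k<7) (unit-literal k k<7) , + k , ≈-refl)

  sign-9 : HasSign Sign.+ (+ 9)
  sign-9 = sign-literal² 3 (ℕ.m≤m+n 4 3)

  sign-16 : HasSign Sign.+ (+ 16)
  sign-16 = sign-literal² 4 (ℕ.m≤m+n 5 2)

  sign-25 : HasSign Sign.+ (+ 25)
  sign-25 = sign-literal² 5 (ℕ.m≤m+n 6 1)

  -- The triple 3² + 4² = 5² consists of units for every prime q ≥ 7. Modulo 3 and modulo 5 no two
  -- nonzero squares add up to a nonzero square, which explains the bound 7.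
  sum+++ : SumOfSigns Sign.+ Sign.+ Sign.+
  sum+++ = + 9 , + 16 , sign-9 , sign-16 , sign-25

  -- If g + 1 is the least nonsquare, then g is a square.
  sum++- : SumOfSigns Sign.+ Sign.+ Sign.-
  sum++- = 1ℤ , + proj₁ least-nonsquare , sign-1
    , (proj₁ (proj₂ least-nonsquare) , proj₁ (proj₂ (proj₂ least-nonsquare))) , sign-nonsquare

  -- If -1 is a square, use (g + 1) - 1 = g, and otherwise 25 - 16 = 9.
  sum+-+ : SumOfSigns Sign.+ Sign.- Sign.+
  sum+-+ = by-sign (proj₁ (sign-of (- 1ℤ) u)) (proj₂ (sign-of (- 1ℤ) u))
    where
    u : Unit (- 1ℤ)
    u = unit-neg unit-1
    by-sign : ∀ s → HasSign s (- 1ℤ) → SumOfSigns Sign.+ Sign.- Sign.+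
    by-sign Sign.+ s = - 1ℤ , nonsquare , s , sign-nonsquare
      , proj₁ (proj₂ least-nonsquare) , proj₁ (proj₂ (proj₂ least-nonsquare))
    by-sign Sign.- s = + 25 , - 1ℤ * + 16 , sign-25 , sign-* Sign.- Sign.+ (- 1ℤ) (+ 16) s sign-16 , sign-9

  -- Multiplication by a nonsquare flips all three signs and commutativity exchanges the first two;
  -- this reduces the eight patterns to the three above.
  sumOfSigns : ∀ s t u → SumOfSigns s t u
  sumOfSigns Sign.+ Sign.+ Sign.+ = sum+++
  sumOfSigns Sign.+ Sign.+ Sign.- = sum++-
  sumOfSigns Sign.+ Sign.- Sign.+ = sum+-+
  sumOfSigns Sign.+ Sign.- Sign.- = sumOfSigns-opposite Sign.- Sign.+ Sign.+ (sumOfSigns-swap Sign.+ Sign.- Sign.+ sum+-+)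
  sumOfSigns Sign.- Sign.+ Sign.+ = sumOfSigns-swap Sign.+ Sign.- Sign.+ sum+-+
  sumOfSigns Sign.- Sign.+ Sign.- = sumOfSigns-opposite Sign.+ Sign.- Sign.+ sum+-+
  sumOfSigns Sign.- Sign.- Sign.+ = sumOfSigns-opposite Sign.+ Sign.+ Sign.- sum++-
  sumOfSigns Sign.- Sign.- Sign.- = sumOfSigns-opposite Sign.+ Sign.+ Sign.+ sum+++

  ratio : ∀ s t x y → HasSign s x → HasSign t y → ∃ λ a → HasSign (s Sign.* t) a × a * y ≈ x
  ratio s t x y sx ty = x * y⁻¹ , sign-* s t x y⁻¹ sx (sign-inverse t y y⁻¹ ty inv)
    , ≈-trans (≡⇒≈ (lemma x y y⁻¹)) (≈-trans (*-congˡ x inv) (≡⇒≈ (ℤ.*-identityʳ x)))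
    where
    y⁻¹ = proj₁ (inverse (hasSign⇒unit t ty))
    inv = proj₂ (inverse (hasSign⇒unit t ty))
    lemma : ∀ x y z → x * z * y ≡ x * (y * z)
    lemma = solve-∀

  sign-cancel : ∀ s t → s Sign.* t Sign.* t ≡ s
  sign-cancel s t = trans (Sign.*-assoc s t t) (trans (cong (s Sign.*_) (Sign.s*s≡+ t)) (Sign.*-identityʳ s))

  -- A solution u + v = w in the required classes is scaled by the square t / w.
  represent : ∀ s₁ s₂ x y t → Unit x → Unit y → Unit t →
    ∃₂ λ a b → HasSign s₁ a × HasSign s₂ b × a * x + b * y ≈ t
  represent s₁ s₂ x y t ux uy ut = a , b
    , subst (λ s → HasSign s a) (sign-cancel s₁ sx) (proj₁ (proj₂ u/x))
    , subst (λ s → HasSign s b) (sign-cancel s₂ sy) (proj₁ (proj₂ v/y))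
    , ≈-trans (+-cong (proj₂ (proj₂ u/x)) (proj₂ (proj₂ v/y)))
        (≈-trans (≡⇒≈ (sym (ℤ.*-distribˡ-+ c u v))) (proj₂ (proj₂ t/w)))
    where
    sx = proj₁ (sign-of x ux)
    sy = proj₁ (sign-of y uy)
    st = proj₁ (sign-of t ut)
    -- With a = c u / x and c a square, `a` has sign `s₁` when `u` has sign `s₁` times that of `x`,
    -- and likewise for `b`. The sum w = u + v gets the sign of `t`, which makes c = t / w a square.
    sol = sumOfSigns (s₁ Sign.* sx) (s₂ Sign.* sy) st
    u = proj₁ sol
    v = proj₁ (proj₂ sol)
    t/w = ratio st st t (u + v) (proj₂ (sign-of t ut)) (proj₂ (proj₂ (proj₂ (proj₂ sol))))
    c = proj₁ t/w
    c+ : HasSign Sign.+ c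
    c+ = subst (λ s → HasSign s c) (Sign.s*s≡+ st) (proj₁ (proj₂ t/w))
    u/x = ratio (s₁ Sign.* sx) sx (c * u) x
            (sign-* Sign.+ (s₁ Sign.* sx) c u c+ (proj₁ (proj₂ (proj₂ sol)))) (proj₂ (sign-of x ux))
    v/y = ratio (s₂ Sign.* sy) sy (c * v) y
            (sign-* Sign.+ (s₂ Sign.* sy) c v c+ (proj₁ (proj₂ (proj₂ (proj₂ sol))))) (proj₂ (sign-of y uy))
    a = proj₁ u/x
    b = proj₁ v/y

-- Weighted sums modulo a prime with prescribed quadratic characters

module Counting {A : Set} {Z : Pred A 0ℓ} (Z? : Decidable Z) where

  #nonzero : List A → ℕ
  #nonzero = length ∘ filter (¬? ∘ Z?)

  #-zero : ∀ {t T} → Z t → #nonzero (t ∷ T) ≡ #nonzero T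
  #-zero z = cong length (filter-reject (¬? ∘ Z?) (λ ¬z → ¬z z))

  #-nonzero : ∀ {t T} → ¬ Z t → #nonzero (t ∷ T) ≡ suc (#nonzero T)
  #-nonzero ¬z = cong length (filter-accept (¬? ∘ Z?) ¬z)

record Support₂ {A : Set} (Z : Pred A 0ℓ) (T : List A) (i j : Fin (length T)) : Set where
  constructor support
  field
    distinct : i ≢ j
    nonzeroˡ : ¬ Z (lookup T i)
    nonzeroʳ : ¬ Z (lookup T j)
    others   : ∀ k → k ≢ i → k ≢ j → Z (lookup T k)

module _ {A : Set} (v : A → ℤ) where

  dot : (T : List A) → (Fin (length T) → ℤ) → ℤ
  dot []      w = 0ℤ
  dot (t ∷ T) w = w zero * v t + dot T (w ∘ suc)

  dot-scale : ∀ T b w → dot T (λ i → b * w i) ≡ b * dot T w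
  dot-scale []      b w = sym (ℤ.*-zeroʳ b)
  dot-scale (t ∷ T) b w = trans (cong (λ z → b * w zero * v t + z) (dot-scale T b (w ∘ suc)))
    (lemma b (w zero) (v t) (dot T (w ∘ suc)))
    where
    lemma : ∀ b w y s → b * w * y + b * s ≡ b * (w * y + s)
    lemma = solve-∀

  VanishesMod : ℕ → Pred A 0ℓ
  VanishesMod q t = Mod._≈_ q (v t) 0ℤ

  vanishesMod? : ∀ q → Decidable (VanishesMod q)
  vanishesMod? q t = Mod._≈?_ q (v t) 0ℤ

  #nonzeroMod : ℕ → List A → ℕ
  #nonzeroMod q = Counting.#nonzero (vanishesMod? q)

module LocalSolutions (q : ℕ) (q-prime : Prime q) (7≤q : 7 ≤ q) {A : Set} (v : A → ℤ) where

  open QuadraticCharacter q q-prime 7≤q public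

  open Counting (vanishesMod? v q) public

  private
    Zero = VanishesMod v q
    Zero? = vanishesMod? v q

  HasSigns : (T : List A) → (Fin (length T) → Sign) → (Fin (length T) → ℤ) → Set
  HasSigns T ε w = ∀ i → HasSign (ε i) (w i)

  Signs : List A → Set
  Signs T = Fin (length T) → Sign

  -- The target `c` is arbitrary because the inductions split off the head, and the tail must then
  -- reach its negative.
  Solves : (T : List A) → ℤ → Signs T → Set
  Solves T c ε = ∃ λ w → HasSigns T ε w × dot v T w ≈ c

  extend : ∀ {t T c ε} a w → HasSign (ε zero) a → HasSigns T (ε ∘ suc) w →
    a * v t + dot v T w ≈ c → Solves (t ∷ T) c ε
  extend a w sa sw eq = a Vector.∷ w , (λ { zero → sa ; (suc i) → sw i }) , eq

  zero-term : ∀ {t} a s → Zero t → a * v t + s ≈ s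
  zero-term {t} a s z = ≈-trans (+-cong (≈-trans (*-congˡ a z) (≡⇒≈ (ℤ.*-zeroʳ a))) (≈-refl {s}))
    (≡⇒≈ (ℤ.+-identityˡ s))

  extend-zero : ∀ {t T c ε} → Zero t → Solves T c (ε ∘ suc) → Solves (t ∷ T) c ε
  extend-zero {t} {T} {c} {ε} z (w , sw , eq) =
    extend {t} {T} {c} {ε} a w (proj₂ (of-sign (ε zero))) sw (≈-trans (zero-term {t} a (dot v T w) z) eq)
    where a = proj₁ (of-sign (ε zero))

  no-nonzero : ∀ T ε → #nonzero T ≡ 0 → Solves T 0ℤ ε
  no-nonzero [] ε eq = (λ ()) , (λ ()) , ≈-refl
  no-nonzero (t ∷ T) ε eq = go (Zero? t)
    where
    go : Dec (Zero t) → Solves (t ∷ T) 0ℤ ε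
    go (yes z) = extend-zero {t} {T} {_} {ε} z (no-nonzero T (ε ∘ suc) (trans (sym (#-zero z)) eq))
    go (no ¬z) = case trans (sym (#-nonzero ¬z)) eq of λ ()

  unit-dot : ∀ T ε → 1 ≤ #nonzero T → ∃ λ w → HasSigns T ε w × Unit (dot v T w)
  unit-dot (t ∷ T) ε c≥1 = go (Zero? t)
    where
    a = proj₁ (of-sign (ε zero))
    sa = proj₂ (of-sign (ε zero))
    Goal = ∃ λ w → HasSigns (t ∷ T) ε w × Unit (dot v (t ∷ T) w)
    cons : ∀ b → HasSign (ε zero) b → ∀ w → HasSigns T (ε ∘ suc) w →
      Unit (b * v t + dot v T w) → Goal
    cons b sb w sw u = b Vector.∷ w , (λ { zero → sb ; (suc i) → sw i }) , u
    go : Dec (Zero t) → Goal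
    go (yes z) = case unit-dot T (ε ∘ suc) (subst (1 ≤_) (#-zero z) c≥1) of λ where
      (w , sw , u) → cons a sa w sw (unit-≈ (≈-sym (zero-term {t} a (dot v T w) z)) u)
    go (no ¬z) = choose ((a * v t + s) ≈? 0ℤ)
      where
      w = λ i → proj₁ (of-sign (ε (suc i)))
      sw = λ i → proj₂ (of-sign (ε (suc i)))
      s = dot v T w
      lemma : ∀ c a y s → c * a * y + s - (a * y + s) ≡ (c - 1ℤ) * (a * y)
      lemma = solve-∀
      choose : Dec (a * v t + s ≈ 0ℤ) → Goal
      choose (no u) = cons a sa w sw u
      -- The factor 4 is a square, so it keeps the sign of `a`; it changes the vanishing sum by 3 a
      -- (v t), which is a unit.
      choose (yes p) = cons (+ 4 * a)
        (sign-* Sign.+ (ε zero) (+ 4) a (sign-literal² 2 (ℕ.m≤m+n 3 4)) sa) w sw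
        λ p′ → unit-* {+ 3} (unit-literal 3 (ℕ.m≤m+n 4 3)) (unit-* (hasSign⇒unit (ε zero) sa) ¬z)
          (≈-trans (≡⇒≈ (sym (lemma (+ 4) a (v t) s))) (-≈0 (≈-trans p′ (≈-sym p))))

  -- The tail is first given any nonzero value and then counts as a single term: `represent` finds a
  -- head weight and a square factor `b` for the whole tail, and a square factor preserves all
  -- signs.
  reach-unit : ∀ T ε c → 2 ≤ #nonzero T → Unit c → Solves T c ε
  reach-unit (t ∷ T) ε c c≥2 uc = go (Zero? t)
    where
    go : Dec (Zero t) → Solves (t ∷ T) c ε
    go (yes z) = extend-zero {t} {T} {_} {ε} z (reach-unit T (ε ∘ suc) c (subst (2 ≤_) (#-zero z) c≥2) uc)
    go (no ¬z) = scale (unit-dot T (ε ∘ suc) (s≤s⁻¹ (subst (2 ≤_) (#-nonzero ¬z) c≥2)))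
      where
      scale : (∃ λ w → HasSigns T (ε ∘ suc) w × Unit (dot v T w)) → Solves (t ∷ T) c ε
      scale (w , sw , u) = case represent (ε zero) Sign.+ (v t) (dot v T w) c ¬z u uc of λ where
        (a , b , sa , sb , eq) → extend {t} {T} {c} {ε} a (λ i → b * w i) sa
          (λ i → sign-* Sign.+ (ε (suc i)) b (w i) sb (sw i))
          (≈-trans (≡⇒≈ (cong (λ z → a * v t + z) (dot-scale v T b w))) eq)

  cancel-head : ∀ a y s → s ≈ a * (- y) → a * y + s ≈ 0ℤ
  cancel-head a y s p = ≈-trans (+-cong (≈-refl {a * y}) p) (≡⇒≈ (lemma a y))
    where
    lemma : ∀ a y → a * y + a * (- y) ≡ 0ℤ
    lemma = solve-∀

  -- The first nonzero term gets any weight of its sign. Two nonzero terms remain, enough to reach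
  -- the unit that cancels it.
  three-nonzero : ∀ T ε → 3 ≤ #nonzero T → Solves T 0ℤ ε
  three-nonzero (t ∷ T) ε c≥3 = go (Zero? t)
    where
    a = proj₁ (of-sign (ε zero))
    sa = proj₂ (of-sign (ε zero))
    go : Dec (Zero t) → Solves (t ∷ T) 0ℤ ε
    go (yes z) = extend-zero {t} {T} {_} {ε} z (three-nonzero T (ε ∘ suc) (subst (3 ≤_) (#-zero z) c≥3))
    go (no ¬z) = case reach-unit T (ε ∘ suc) (a * (- v t)) (s≤s⁻¹ (subst (3 ≤_) (#-nonzero ¬z) c≥3))
                        (unit-* (hasSign⇒unit (ε zero) sa) (unit-neg ¬z)) of λ where
      (w , sw , eq) → extend {t} {T} {0ℤ} {ε} a w sa sw (cancel-head a (v t) (dot v T w) eq)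

  #0⇒zero : ∀ T → #nonzero T ≡ 0 → ∀ k → Zero (lookup T k)
  #0⇒zero (t ∷ T) eq = go (Zero? t)
    where
    go : Dec (Zero t) → ∀ k → Zero (lookup (t ∷ T) k)
    go (yes z) zero = z
    go (yes z) (suc k) = #0⇒zero T (trans (sym (#-zero z)) eq) k
    go (no ¬z) = case trans (sym (#-nonzero ¬z)) eq of λ ()

  -- `σ` is the character of the single nonzero term: its weight has to be `c` divided by that term.
  record OneNonzero (T : List A) : Set where
    field
      position : Fin (length T)
      nonzero  : ¬ Zero (lookup T position)
      others   : ∀ k → k ≢ position → Zero (lookup T k)
      σ        : Sign
      solve    : ∀ ε c s → HasSign s c → ε position ≡ s Sign.* σ → Solves T c ε

  one-nonzero : ∀ T → #nonzero T ≡ 1 → OneNonzero T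
  one-nonzero (t ∷ T) eq = go (Zero? t)
    where
    go : Dec (Zero t) → OneNonzero (t ∷ T)
    go (yes z) = record
      { position = suc position
      ; nonzero = nonzero
      ; others = λ { zero _ → z ; (suc k) k≢ → others k (k≢ ∘ cong suc) }
      ; σ = σ
      ; solve = λ ε c s sc e → extend-zero {t} {T} {_} {ε} z (solve (ε ∘ suc) c s sc e)
      }
      where open OneNonzero (one-nonzero T (trans (sym (#-zero z)) eq))
    go (no ¬z) = record
      { position = zero
      ; nonzero = ¬z
      ; others = λ { zero k≢ → contradiction refl k≢ ; (suc k) _ → #0⇒zero T c≡0 k }
      ; σ = proj₁ (sign-of (v t) ¬z)
      ; solve = solution
      }
      where
      c≡0 : #nonzero T ≡ 0
      c≡0 = ℕ.suc-injective (trans (sym (#-nonzero ¬z)) eq)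
      σ₀ = proj₁ (sign-of (v t) ¬z)
      solution : ∀ ε c s → HasSign s c → ε zero ≡ s Sign.* σ₀ → Solves (t ∷ T) c ε
      solution ε c s sc e = combine (ratio s σ₀ c (v t) sc (proj₂ (sign-of (v t) ¬z))) (no-nonzero T (ε ∘ suc) c≡0)
        where
        combine : (∃ λ a → HasSign (s Sign.* σ₀) a × a * v t ≈ c) → Solves T 0ℤ (ε ∘ suc) → Solves (t ∷ T) c ε
        combine (a , sa , ay≈c) (w , sw , eq₀) = extend {t} {T} {c} {ε} a w
          (subst (λ r → HasSign r a) (sym e) sa) sw
          (≈-trans (+-cong ay≈c eq₀) (≡⇒≈ (ℤ.+-identityʳ c)))

  -- For nonzero terms x and y, the equation a x + b y = 0 makes a b equal to -x y up to a square
  -- factor; `σ` is the character of -x y.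
  record TwoNonzero (T : List A) : Set where
    field
      {posˡ posʳ} : Fin (length T)
      supported : Support₂ Zero T posˡ posʳ
      σ         : Sign
      solve     : ∀ ε → ε posˡ Sign.* ε posʳ ≡ σ → Solves T 0ℤ ε

  two-nonzero : ∀ T → #nonzero T ≡ 2 → TwoNonzero T
  two-nonzero (t ∷ T) eq = go (Zero? t)
    where
    go : Dec (Zero t) → TwoNonzero (t ∷ T)
    go (yes z) = record
      { supported = support (distinct ∘ Fin.suc-injective) nonzeroˡ nonzeroʳ
          λ { zero _ _ → z ; (suc k) k≢i k≢j → others k (k≢i ∘ cong suc) (k≢j ∘ cong suc) }
      ; σ = σ
      ; solve = λ ε e → extend-zero {t} {T} {_} {ε} z (solve (ε ∘ suc) e)
      }
      where
      open TwoNonzero (two-nonzero T (trans (sym (#-zero z)) eq))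
      open Support₂ supported
    go (no ¬z) = record
      { supported = support (λ ()) ¬z nonzero
          λ { zero 0≢0 _ → contradiction refl 0≢0 ; (suc k) _ k≢j → others k (k≢j ∘ cong suc) }
      ; σ = σ₀ Sign.* σ
      ; solve = solution
      }
      where
      open OneNonzero (one-nonzero T (ℕ.suc-injective (trans (sym (#-nonzero ¬z)) eq)))
      σ₀ = proj₁ (sign-of (- v t) (unit-neg ¬z))
      sign-solve : ∀ e f s t → e Sign.* f ≡ s Sign.* t → f ≡ e Sign.* s Sign.* t
      sign-solve e f s t p = Sign.*-cancelˡ-≡ e f (e Sign.* s Sign.* t) (trans p
        (trans (sym (cong (Sign._* (s Sign.* t)) (Sign.s*s≡+ e)))
          (trans (Sign.*-assoc e e (s Sign.* t)) (cong (e Sign.*_) (sym (Sign.*-assoc e s t))))))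
      solution : ∀ ε → ε zero Sign.* ε (suc position) ≡ σ₀ Sign.* σ → Solves (t ∷ T) 0ℤ ε
      solution ε e = combine (solve (ε ∘ suc) (a * (- v t)) (ε zero Sign.* σ₀)
          (sign-* (ε zero) σ₀ a (- v t) sa (proj₂ (sign-of (- v t) (unit-neg ¬z))))
          (sign-solve (ε zero) (ε (suc position)) σ₀ σ e))
        where
        a = proj₁ (of-sign (ε zero))
        sa = proj₂ (of-sign (ε zero))
        combine : Solves T (a * (- v t)) (ε ∘ suc) → Solves (t ∷ T) 0ℤ ε
        combine (w , sw , eq₀) = extend {t} {T} {0ℤ} {ε} a w sa sw (cancel-head a (v t) (dot v T w) eq₀)

  solve-signs : ∀ T → #nonzero T ≢ 1 → (∀ ε → Solves T 0ℤ ε) ⊎ (#nonzero T ≡ 2 × TwoNonzero T)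
  solve-signs T c≢1 = go (#nonzero T) refl
    where
    go : ∀ c → #nonzero T ≡ c → (∀ ε → Solves T 0ℤ ε) ⊎ (#nonzero T ≡ 2 × TwoNonzero T)
    go 0 eq = inj₁ λ ε → no-nonzero T ε eq
    go 1 eq = contradiction eq c≢1
    go 2 eq = inj₂ (eq , two-nonzero T eq)
    go (suc (suc (suc c))) eq = inj₁ λ ε → three-nonzero T ε (subst (3 ≤_) (sym eq) (s≤s (s≤s (s≤s z≤n))))

-- Gluing weights by the Chinese remainder theorem

Congruent : ℕ → ℤ → ℤ → Set
Congruent q a b = Mod._≈_ q a b

congruent-∣ : ∀ {m n a b} → m ℕ.∣ n → Congruent n a b → Congruent m a b
congruent-∣ m∣n (Mod.congruent d) = Mod.congruent (ℤ.∣-trans (ℤ.∣ᵤ⇒∣ m∣n) d)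

convex-combination : ∀ a b x y → x + y ≡ 1ℤ → a * x + b * y - a ≡ (b - a) * y
convex-combination a b x y x+y≡1 = trans
  (cong (λ z → a * x + b * y - z) (trans (sym (ℤ.*-identityʳ a)) (cong (a *_) (sym x+y≡1))))
  (lemma a b x y)
  where
  lemma : ∀ a b x y → a * x + b * y - a * (x + y) ≡ (b - a) * y
  lemma = solve-∀

chinese-remainder : ∀ {m n} → ℕ.Coprime m n → ∀ a b → ∃ λ c → Congruent m c a × Congruent n c b
chinese-remainder {m} {n} coprime a b = combine (bézout coprime)
  where
  combine : (∃₂ λ u v → u * + m + v * + n ≡ 1ℤ) → ∃ λ c → Congruent m c a × Congruent n c b
  combine (u , v , eq) = a * y + b * x
    , Mod.≈-by-multiple m (b - a) x (Mod.∣⇒≈0 m (divides u refl))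
        (convex-combination a b y x (trans (ℤ.+-comm y x) eq))
    , Mod.≈-trans n (Mod.≡⇒≈ n (ℤ.+-comm (a * y) (b * x)))
        (Mod.≈-by-multiple n (a - b) y (Mod.∣⇒≈0 n (divides v refl)) (convex-combination b a x y eq))
    where
    x = u * + m
    y = v * + n

-- Pairwise coprimality in the form that gluing one prime at a time uses.
CoprimeFactors : List ℕ → Set
CoprimeFactors []       = ⊤
CoprimeFactors (q ∷ qs) = ℕ.Coprime q (product qs) × CoprimeFactors qs

coprime-primes : ∀ {q} qs → Prime q → All Prime qs → ℕ.Coprime q (product qs) → All (λ r → ¬ r ℕ.∣ q) qs
coprime-primes []       _  _          _ = []
coprime-primes {q} (r ∷ qs) pr (pr′ ∷ prs) c =
  (λ r∣q → case c (r∣q , ℕ.m∣m*n {r} (product qs)) of λ { refl → ¬prime[1] pr′ })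
  ∷ coprime-primes qs pr prs (λ (d∣q , d∣qs) → c (d∣q , ℕ.∣-trans d∣qs (ℕ.n∣m*n r {product qs})))

-- This keeps the nondivisibility hypothesis alive in the recursion on the ruler sequence, where `c`
-- becomes `c ℕ.* q`.
prime∤* : ∀ {q qs c} → Prime q → All Prime qs → ℕ.Coprime q (product qs) → All (λ r → ¬ r ℕ.∣ c) qs →
  All (λ r → ¬ r ℕ.∣ c ℕ.* q) qs
prime∤* {q} {qs} {c} pr prs co qs∤c = All.zipWith
  (λ (pr′ , r∤c , r∤q) r∣cq → [ r∤c , r∤q ]′ (euclidsLemma c q pr′ r∣cq))
  (prs , All.zip (qs∤c , coprime-primes qs pr prs co))

congruent-factors : ∀ qs {a b} → Congruent (product qs) a b → All (λ q → Congruent q a b) qs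
congruent-factors []       _ = []
congruent-factors (q ∷ qs) p = congruent-∣ (ℕ.m∣m*n {q} (product qs)) p
  ∷ congruent-factors qs (congruent-∣ (ℕ.n∣m*n q {product qs}) p)

-- The Jacobi symbol as a certificate that lists its local characters. It contains the information
-- that `a` is a unit modulo every prime of the list.
HasJacobi : List ℕ → Sign → ℤ → Set
HasJacobi []       s a = s ≡ Sign.+
HasJacobi (q ∷ qs) s a = ∃₂ λ t u → Mod.HasSign q t a × HasJacobi qs u a × t Sign.* u ≡ s

hasJacobi-≈ : ∀ qs {s a b} → All (λ q → Congruent q a b) qs → HasJacobi qs s a → HasJacobi qs s b
hasJacobi-≈ []       _        eq                  = eq
hasJacobi-≈ (q ∷ qs) (p ∷ ps) (t , u , st , ju , eq) = t , u , Mod.sign-≈ q t p st , hasJacobi-≈ qs ps ju , eq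

AdmissiblePrime : ℕ → Set
AdmissiblePrime q = Prime q × 7 ≤ q

-- Sign patterns with prescribed products at two pairs of positions

spike : ∀ {r} → Fin r → Sign → (Fin r → Sign) → Fin r → Sign
spike i s δ k = case k Fin.≟ i of λ { (yes _) → s ; (no _) → δ k }

spike-at : ∀ {r} (i : Fin r) s δ → spike i s δ i ≡ s
spike-at i s δ with i Fin.≟ i
... | yes _ = refl
... | no i≢i = contradiction refl i≢i

spike-off : ∀ {r} (i : Fin r) s δ k → k ≢ i → spike i s δ k ≡ δ k
spike-off i s δ k k≢i with k Fin.≟ i
... | yes k≡i = contradiction k≡i k≢i
... | no _ = refl

with-product : ∀ {r} (i j : Fin r) → i ≢ j → ∀ σ → ∃ λ (δ : Fin r → Sign) → δ i Sign.* δ j ≡ σ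
with-product i j i≢j σ = spike i σ (λ _ → Sign.+)
  , trans (cong₂ Sign._*_ (spike-at i σ _) (spike-off i σ _ j (i≢j ∘ sym))) (Sign.*-identityʳ σ)

-- δ is free at a position k outside {i, j}, so the two conditions are independent.
with-products : ∀ {r} (i j k l : Fin r) → i ≢ j → k ≢ l → k ≢ i → k ≢ j → ∀ σ τ →
  ∃ λ (δ : Fin r → Sign) → δ i Sign.* δ j ≡ σ × δ k Sign.* δ l ≡ τ
with-products i j k l i≢j k≢l k≢i k≢j σ τ = spike k s δ₀
  , trans (cong₂ Sign._*_ (spike-off k s δ₀ i (k≢i ∘ sym)) (spike-off k s δ₀ j (k≢j ∘ sym)))
      (proj₂ (with-product i j i≢j σ))
  , trans (cong₂ Sign._*_ (spike-at k s δ₀) (spike-off k s δ₀ l (k≢l ∘ sym)))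
      (trans (Sign.*-assoc τ (δ₀ l) (δ₀ l)) (trans (cong (τ Sign.*_) (Sign.s*s≡+ (δ₀ l))) (Sign.*-identityʳ τ)))
  where
  δ₀ = proj₁ (with-product i j i≢j σ)
  s = τ Sign.* δ₀ l

-- Two unordered pairs coincide, or the second has a member outside the first; that member is the
-- free position for `with-products`.
data Pairs {r} (i j k l : Fin r) : Set where
  same    : k ≡ i → l ≡ j → Pairs i j k l
  swapped : k ≡ j → l ≡ i → Pairs i j k l
  newˡ    : k ≢ i → k ≢ j → Pairs i j k l
  newʳ    : l ≢ i → l ≢ j → Pairs i j k l

pairs : ∀ {r} (i j k l : Fin r) → k ≢ l → Pairs i j k l
pairs i j k l k≢l with k Fin.≟ i | k Fin.≟ j | l Fin.≟ i | l Fin.≟ j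
... | no k≢i   | no k≢j   | _        | _        = newˡ k≢i k≢j
... | _        | _        | no l≢i   | no l≢j   = newʳ l≢i l≢j
... | yes refl | _        | yes refl | _        = contradiction refl k≢l
... | yes refl | _        | no _     | yes refl = same refl refl
... | no _     | yes refl | yes refl | _        = swapped refl refl
... | no _     | yes refl | no _     | yes refl = contradiction refl k≢l

Independent : ∀ {r} → (i j k l : Fin r) → Set
Independent {r} i j k l = ∀ σ τ → ∃ λ (δ : Fin r → Sign) → δ i Sign.* δ j ≡ σ × δ k Sign.* δ l ≡ τ

*-cancel-self : ∀ s t → s Sign.* (s Sign.* t) ≡ t
*-cancel-self s t = trans (sym (Sign.*-assoc s s t)) (cong (Sign._* t) (Sign.s*s≡+ s))

*-interchange : ∀ a b c d → (a Sign.* c) Sign.* (b Sign.* d) ≡ (a Sign.* b) Sign.* (c Sign.* d)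
*-interchange a b c d = trans (Sign.*-assoc a c (b Sign.* d))
  (trans (cong (a Sign.*_) (trans (sym (Sign.*-assoc c b d))
    (trans (cong (Sign._* d) (Sign.*-comm c b)) (Sign.*-assoc b c d))))
  (sym (Sign.*-assoc a b (c Sign.* d))))

-- Solvable sign patterns modulo several primes

module _ {A : Set} (v : A → ℤ) where

  dot-≈ : ∀ q T {w w′} → (∀ i → Congruent q (w i) (w′ i)) → Congruent q (dot v T w) (dot v T w′)
  dot-≈ q []      p = Mod.≈-refl q
  dot-≈ q (t ∷ T) p = Mod.+-cong q (Mod.*-congʳ q (v t) (p zero)) (dot-≈ q T (λ i → p (suc i)))

  Annihilates : ℕ → (T : List A) → (Fin (length T) → ℤ) → Set
  Annihilates q T w = Congruent q (dot v T w) 0ℤ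

  Achieves : List ℕ → (T : List A) → (Fin (length T) → Sign) → Set
  Achieves qs T ε = ∃ λ w → (∀ i → HasJacobi qs (ε i) (w i)) × All (λ q → Annihilates q T w) qs

  annihilates-≈ : ∀ q T {w w′} → (∀ i → Congruent q (w′ i) (w i)) → Annihilates q T w → Annihilates q T w′
  annihilates-≈ q T p eq = Mod.≈-trans q (dot-≈ q T p) eq

  annihilates-all-≈ : ∀ qs T {w w′} → (∀ i → All (λ q → Congruent q (w′ i) (w i)) qs) →
    All (λ q → Annihilates q T w) qs → All (λ q → Annihilates q T w′) qs
  annihilates-all-≈ []       T p []         = []
  annihilates-all-≈ (q ∷ qs) T p (eq ∷ eqs) =
    annihilates-≈ q T (λ i → All.head (p i)) eq ∷ annihilates-all-≈ qs T (λ i → All.tail (p i)) eqs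

  glue : ∀ {q qs} → ℕ.Coprime q (product qs) → ∀ {r} (w w′ : Fin r → ℤ) →
    ∃ λ w″ → (∀ i → Congruent q (w″ i) (w i)) × (∀ i → All (λ p → Congruent p (w″ i) (w′ i)) qs)
  glue {q} {qs} c w w′ = (λ i → proj₁ (crt i)) , (λ i → proj₁ (proj₂ (crt i)))
    , λ i → congruent-factors qs (proj₂ (proj₂ (crt i)))
    where
    crt = λ i → chinese-remainder c (w i) (w′ i)

  SolvesMod : ℕ → (T : List A) → (Fin (length T) → Sign) → Set
  SolvesMod q T δ = ∃ λ w → (∀ i → Mod.HasSign q (δ i) (w i)) × Annihilates q T w

  achieves-∷ : ∀ {q qs} T δ η ε → ℕ.Coprime q (product qs) → (∀ i → δ i Sign.* η i ≡ ε i) →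
    SolvesMod q T δ → Achieves qs T η → Achieves (q ∷ qs) T ε
  achieves-∷ {q} {qs} T δ η ε c δη≡ε (w , sw , aw) (w′ , jw′ , aw′) = combine (glue {q} {qs} c w w′)
    where
    combine : (∃ λ w″ → (∀ i → Congruent q (w″ i) (w i)) × (∀ i → All (λ p → Congruent p (w″ i) (w′ i)) qs)) →
      Achieves (q ∷ qs) T ε
    combine (w″ , ≈w , ≈w′) = w″
      , (λ i → δ i , η i , Mod.sign-≈ q (δ i) (Mod.≈-sym q (≈w i)) (sw i)
          , hasJacobi-≈ qs (All.map (λ {p} → Mod.≈-sym p) (≈w′ i)) (jw′ i) , δη≡ε i)
      , annihilates-≈ q T ≈w aw ∷ annihilates-all-≈ qs T ≈w′ aw′

  achieves-[] : ∀ T ε → (∀ i → ε i ≡ Sign.+) → Achieves [] T ε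
  achieves-[] T ε ε≡+ = (λ _ → 0ℤ) , ε≡+ , []

  -- `P` is left open so that one record covers the patterns solvable modulo one prime (`SolvesMod`)
  -- and the Jacobi patterns over a list (`Achieves`).
  record TwoNonzeroMod (qs : List ℕ) (T : List A) (P : (Fin (length T) → Sign) → Set) : Set where
    field
      two       : All (λ q → #nonzeroMod v q T ≡ 2) qs
      {posˡ posʳ} : Fin (length T)
      supported : All (λ q → Support₂ (VanishesMod v q) T posˡ posʳ) qs
      distinct  : posˡ ≢ posʳ
      σ         : Sign
      solve     : ∀ ε → ε posˡ Sign.* ε posʳ ≡ σ → P ε

  -- The invariant of the induction over the primes: no restriction on signs at all, or one
  -- restriction at a pair common to all the primes.
  Solvability : List ℕ → (T : List A) → ((Fin (length T) → Sign) → Set) → Set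
  Solvability qs T P = (∀ ε → P ε) ⊎ TwoNonzeroMod qs T P

  solvability-prime : ∀ {q} → AdmissiblePrime q → ∀ T → #nonzeroMod v q T ≢ 1 →
    Solvability (q ∷ []) T (SolvesMod q T)
  solvability-prime {q} (q-prime , 7≤q) T c≢1 = case LocalSolutions.solve-signs q q-prime 7≤q v T c≢1 of λ where
    (inj₁ full) → inj₁ full
    (inj₂ (c≡2 , pair)) → inj₂ (let open LocalSolutions.TwoNonzero pair in record
      { two = c≡2 ∷ [] ; supported = supported ∷ [] ; distinct = Support₂.distinct supported
      ; σ = σ ; solve = solve })

  solvability-nonempty : ∀ {qs T P} → Solvability qs T P → ∃ P
  solvability-nonempty (inj₁ full) = (λ _ → Sign.+) , full _
  solvability-nonempty (inj₂ pair) = proj₁ δ , solve (proj₁ δ) (proj₂ δ)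
    where
    open TwoNonzeroMod pair
    δ = with-product posˡ posʳ distinct σ

  support-swap : ∀ {Z : Pred A _} {T i j} → Support₂ Z T i j → Support₂ Z T j i
  support-swap (support i≢j zi zj others) = support (i≢j ∘ sym) zj zi (λ k k≢j k≢i → others k k≢i k≢j)

  -- The sign patterns solvable modulo q times those solvable modulo qs: two
  -- conditions on the same pair of positions merge, all others cancel out.
  solvability-∷ : ∀ {q qs} T → ℕ.Coprime q (product qs) →
    Solvability (q ∷ []) T (SolvesMod q T) → Solvability qs T (Achieves qs T) →
    Solvability (q ∷ qs) T (Achieves (q ∷ qs) T)
  solvability-∷ {q} {qs} T c = combine
    where
    Pattern = Fin (length T) → Sign
    -- Signs are self-inverse, so spending δ modulo `q` leaves δ ε for the other primes.
    by-δ : ∀ (δ ε : Pattern) → SolvesMod q T δ → Achieves qs T (λ i → δ i Sign.* ε i) → Achieves (q ∷ qs) T ε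
    by-δ δ ε = achieves-∷ T δ (λ i → δ i Sign.* ε i) ε c (λ i → *-cancel-self (δ i) (ε i))
    by-η : ∀ (η ε : Pattern) → Achieves qs T η → SolvesMod q T (λ i → ε i Sign.* η i) → Achieves (q ∷ qs) T ε
    by-η η ε a s = achieves-∷ T (λ i → ε i Sign.* η i) η ε c
      (λ i → trans (Sign.*-assoc (ε i) (η i) (η i)) (trans (cong (ε i Sign.*_) (Sign.s*s≡+ (η i))) (Sign.*-identityʳ (ε i)))) s a
    combine : Solvability (q ∷ []) T (SolvesMod q T) → Solvability qs T (Achieves qs T) →
      Solvability (q ∷ qs) T (Achieves (q ∷ qs) T)
    combine (inj₁ full) s = inj₁ λ ε → case solvability-nonempty s of λ where
      (η , a) → by-η η ε a (full _)
    combine s@(inj₂ _) (inj₁ full) = inj₁ λ ε → case solvability-nonempty s of λ where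
      (δ , a) → by-δ δ ε a (full _)
    combine (inj₂ one) (inj₂ many) = by-pairs (pairs i j k l k≢l)
      where
      open TwoNonzeroMod one renaming (posˡ to i; posʳ to j; distinct to i≢j; solve to solve₁; supported to supp₁; two to two₁)
      open TwoNonzeroMod many renaming (posˡ to k; posʳ to l; distinct to k≢l; σ to τ; solve to solve₂; supported to supp₂; two to two₂)
      independent : Independent i j k l → ∀ ε → Achieves (q ∷ qs) T ε
      -- The pattern δ ε must have product τ at `k` and `l`, so δ must have τ times the product of ε
      -- there.
      independent ind ε = case ind σ (τ Sign.* (ε k Sign.* ε l)) of λ where
        (δ , δij , δkl) → by-δ δ ε (solve₁ δ δij) (solve₂ _
          (trans (*-interchange (δ k) (δ l) (ε k) (ε l))
            (trans (cong (Sign._* (ε k Sign.* ε l)) δkl)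
              (trans (Sign.*-assoc τ _ _) (trans (cong (τ Sign.*_) (Sign.s*s≡+ (ε k Sign.* ε l))) (Sign.*-identityʳ τ))))))
      -- If δ has product σ at the common pair and ε has σ τ, then δ ε has product τ, as the other
      -- primes demand.
      dependent : Support₂ (VanishesMod v q) T k l → (∀ (δ : Pattern) → δ i Sign.* δ j ≡ δ k Sign.* δ l) →
        TwoNonzeroMod (q ∷ qs) T (Achieves (q ∷ qs) T)
      dependent supp same-product = record
        { two = All.head two₁ ∷ two₂ ; supported = supp ∷ supp₂ ; distinct = k≢l
        ; σ = σ Sign.* τ
        ; solve = λ ε e → case with-product i j i≢j σ of λ where
            (δ , δij) → by-δ δ ε (solve₁ δ δij) (solve₂ _
              (trans (*-interchange (δ k) (δ l) (ε k) (ε l))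
                (trans (cong₂ Sign._*_ (trans (sym (same-product δ)) δij) e) (*-cancel-self σ τ))))
        }
      by-pairs : Pairs i j k l → Solvability (q ∷ qs) T (Achieves (q ∷ qs) T)
      by-pairs (same k≡i l≡j) = inj₂ (dependent
        (subst (λ x → Support₂ _ T x l) (sym k≡i) (subst (Support₂ _ T i) (sym l≡j) (All.head supp₁)))
        λ δ → cong₂ (λ x y → δ x Sign.* δ y) (sym k≡i) (sym l≡j))
      by-pairs (swapped k≡j l≡i) = inj₂ (dependent
        (subst (λ x → Support₂ _ T x l) (sym k≡j) (subst (Support₂ _ T j) (sym l≡i) (support-swap (All.head supp₁))))
        λ δ → trans (Sign.*-comm (δ i) (δ j)) (cong₂ (λ x y → δ x Sign.* δ y) (sym k≡j) (sym l≡i)))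
      by-pairs (newˡ k≢i k≢j) = inj₁ (independent (with-products i j k l i≢j k≢l k≢i k≢j))
      by-pairs (newʳ l≢i l≢j) = inj₁ (independent λ σ τ →
        case with-products i j l k i≢j (k≢l ∘ sym) l≢i l≢j σ τ of λ where
          (δ , δij , δlk) → δ , δij , trans (Sign.*-comm (δ k) (δ l)) δlk)

  solvability : ∀ q qs T → All AdmissiblePrime (q ∷ qs) → CoprimeFactors (q ∷ qs) →
    All (λ p → #nonzeroMod v p T ≢ 1) (q ∷ qs) → Solvability (q ∷ qs) T (Achieves (q ∷ qs) T)
  solvability q [] T (adm ∷ []) (c , _) (c≢1 ∷ []) = case solvability-prime adm T c≢1 of λ where
      (inj₁ full) → inj₁ λ ε → single ε (full ε)
      (inj₂ pair) → inj₂ (let open TwoNonzeroMod pair in record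
        { two = two ; supported = supported ; distinct = distinct ; σ = σ ; solve = λ ε e → single ε (solve ε e) })
    where
    single : ∀ ε → SolvesMod q T ε → Achieves (q ∷ []) T ε
    single ε s = achieves-∷ {q} {[]} T ε (λ _ → Sign.+) ε c (λ i → Sign.*-identityʳ (ε i)) s (achieves-[] T _ (λ _ → refl))
  solvability q (q′ ∷ qs) T (adm ∷ adms) (c , cs) (c≢1 ∷ cs≢1) =
    solvability-∷ T c (solvability-prime adm T c≢1) (solvability q′ qs T adms cs cs≢1)

  -- Modulo `p` only units are required, since the Legendre symbol at `p` occurs on both sides of
  -- the condition defining `L n p`.
  JacobiSolution : ℕ → List ℕ → List A → Set
  JacobiSolution p qs T = ∃ λ w → (∀ i → Mod.Unit p (w i)) × (∀ i → HasJacobi qs Sign.+ (w i)) ×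
    All (λ q → Annihilates q T w) (p ∷ qs)

  -- The common pair without positions: the counting argument on segments uses only the number of
  -- nonzero terms and the fact that all primes of `qs` have the same vanishing terms.
  SharedPair : List ℕ → List A → Set
  SharedPair qs T = All (λ q → #nonzeroMod v q T ≡ 2) qs ×
    (∀ {q q′ t} → q ∈ qs → q′ ∈ qs → t ∈ T → VanishesMod v q t → VanishesMod v q′ t)

  support-shared : ∀ {Z Z′ : Pred A _} {T i j} → Support₂ Z T i j → Support₂ Z′ T i j →
    ∀ k → Z (lookup T k) → Z′ (lookup T k)
  support-shared {Z} {T = T} s s′ k z = Support₂.others s′ k
    (λ k≡i → Support₂.nonzeroˡ s (subst (Z ∘ lookup T) k≡i z))
    (λ k≡j → Support₂.nonzeroʳ s (subst (Z ∘ lookup T) k≡j z))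

  jacobi-solution : ∀ p q qs T → All AdmissiblePrime (p ∷ q ∷ qs) → CoprimeFactors (p ∷ q ∷ qs) →
    All (λ r → #nonzeroMod v r T ≢ 1) (p ∷ q ∷ qs) → JacobiSolution p (q ∷ qs) T ⊎ SharedPair (q ∷ qs) T
  jacobi-solution p q qs T (adm ∷ adms) (c , cs) (c≢1 ∷ cs≢1) = case solvability q qs T adms cs cs≢1 of λ where
      (inj₁ full) → inj₁ (add-p (full _))
      (inj₂ pair) → let open TwoNonzeroMod pair in inj₂ (two ,
        λ {q} {q′} {t} q∈ q′∈ t∈T z → subst (VanishesMod v q′) (sym (Any.lookup-index t∈T))
          (support-shared {VanishesMod v q} {VanishesMod v q′} (All.lookup supported q∈) (All.lookup supported q′∈) (Any.index t∈T)
            (subst (VanishesMod v q) (Any.lookup-index t∈T) z)))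
    where
    add-p : Achieves (q ∷ qs) T (λ _ → Sign.+) → JacobiSolution p (q ∷ qs) T
    add-p (w′ , jw′ , aw′) = case solvability-nonempty (solvability-prime adm T c≢1) of λ where
      (δ , w , sw , aw) → case glue {p} {q ∷ qs} c w w′ of λ where
        (w″ , ≈w , ≈w′) → w″
          , (λ i → Mod.unit-≈ p (Mod.≈-sym p (≈w i)) (Mod.hasSign⇒unit p (δ i) (sw i)))
          , (λ i → hasJacobi-≈ (q ∷ qs) (All.map (λ {r} → Mod.≈-sym r) (≈w′ i)) (jw′ i))
          , annihilates-≈ p T ≈w aw ∷ annihilates-all-≈ (q ∷ qs) T ≈w′ aw′

-- Weights in ℤ/n

signℤ : Sign → ℤ
signℤ Sign.+ = 1ℤ
signℤ Sign.- = -1ℤ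

signℤ-* : ∀ s t → signℤ (s Sign.* t) ≡ signℤ s * signℤ t
signℤ-* Sign.+ Sign.+ = refl
signℤ-* Sign.+ Sign.- = refl
signℤ-* Sign.- Sign.+ = refl
signℤ-* Sign.- Sign.- = refl

legendre-sign : ∀ {q} → AdmissiblePrime q → ∀ s a → Mod.HasSign q s (+ a) → legendre a q ≡ signℤ s
legendre-sign {q} (q-prime , 7≤q) s a sa = go s sa
  where
  open PrimeField q q-prime 7≤q
  go : ∀ s → HasSign s (+ a) → legendre a q ≡ signℤ s
  go s sa with q ℕ.∣? a | isSquareMod? a q
  go s      sa       | yes d | _      = contradiction (ℕ∣⇒≈0 d) (hasSign⇒unit s sa)
  go Sign.+ sa       | no _  | yes _  = refl
  go Sign.- (_ , ¬sq) | no _ | yes sq = contradiction (IsSquareMod⇒IsSquare a sq) ¬sq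
  go Sign.+ (_ , sq) | no _  | no ¬sq = contradiction (IsSquare⇒IsSquareMod a sq) ¬sq
  go Sign.- sa       | no _  | no _   = refl

foldr-legendre : ∀ qs s a → All AdmissiblePrime qs → HasJacobi qs s (+ a) →
  foldr _*_ 1ℤ (map (legendre a) qs) ≡ signℤ s
foldr-legendre []       s a []           s≡+ = cong signℤ (sym s≡+)
foldr-legendre (q ∷ qs) s a (adm ∷ adms) (t , u , st , ju , eq) = trans
  (cong₂ _*_ (legendre-sign adm t a st) (foldr-legendre qs u a adms ju))
  (trans (sym (signℤ-* t u)) (cong signℤ eq))

foldr-*-middle : ∀ (f : ℕ → ℤ) as p bs →
  foldr _*_ 1ℤ (map f (as ++ p ∷ bs)) ≡ f p * foldr _*_ 1ℤ (map f (as ++ bs))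
foldr-*-middle f []       p bs = refl
foldr-*-middle f (a ∷ as) p bs = trans (cong (f a *_) (foldr-*-middle f as p bs)) (lemma (f a) (f p) _)
  where
  lemma : ∀ x y z → x * (y * z) ≡ y * (x * z)
  lemma = solve-∀

coprime-product : ∀ {a} qs → All Prime qs → All (λ q → ¬ q ℕ.∣ a) qs → ℕ.Coprime a (product qs)
coprime-product []       _        _          (_ , d∣1) = ℕ.∣1⇒≡1 d∣1
coprime-product (q ∷ qs) (pr ∷ prs) (q∤a ∷ qs∤a) {d} (d∣a , d∣qM) =
  coprime-product qs prs qs∤a (d∣a , ℕ.coprime-divisor coprime-d-q d∣qM)
  where
  coprime-d-q : ℕ.Coprime d q
  coprime-d-q (e∣d , e∣q) with prime⇒irreducible pr e∣q
  ... | inj₁ e≡1  = e≡1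
  ... | inj₂ refl = contradiction (ℕ.∣-trans e∣d d∣a) q∤a

product-∣ : ∀ {x} qs → CoprimeFactors qs → All (ℕ._∣ x) qs → product qs ℕ.∣ x
product-∣ {x} []       _        []           = ℕ.1∣ x
product-∣ {x} (q ∷ qs) (c , cs) (q∣x ∷ qs∣x) with product-∣ qs cs qs∣x
... | ℕ.divides k x≡kM = subst (product (q ∷ qs) ℕ.∣_) (sym x≡kM)
      (ℕ.*-monoˡ-∣ (product qs) (ℕ.coprime-divisor c (subst (q ℕ.∣_) (trans x≡kM (ℕ.*-comm k (product qs))) q∣x)))

congruent-product : ∀ {x} qs → CoprimeFactors qs → All (λ q → Congruent q x 0ℤ) qs → Congruent (product qs) x 0ℤ
congruent-product qs cs ps = Mod.∣⇒≈0 (product qs) (ℤ.∣ᵤ⇒∣ (product-∣ qs cs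
  (All.map (λ {q} p → ℤ.∣⇒∣ᵤ (Mod.≈0⇒∣ q p)) ps)))

module Residues (n : ℕ) .{{_ : NonZero n}} where

  open Mod n

  value : ℤ/ n → ℤ
  value x = + toℕ x

  value-⊗ : ∀ (x y : ℤ/ n) → value (x ⊗ y) ≈ value x * value y
  value-⊗ x y = ≈-trans (mod-≈ (toℕ x ℕ.* toℕ y)) (≡⇒≈ (ℤ.pos-* (toℕ x) (toℕ y)))

  value-⊕ : ∀ (x y : ℤ/ n) → value (x ⊕ y) ≈ value x + value y
  value-⊕ x y = mod-≈ (toℕ x ℕ.+ toℕ y)

  -- An integer lift of the sum in ℤ/n, which can also be reduced modulo the prime divisors of `n`.
  weightedSum : List (ℤ/ n) → List (ℤ/ n) → ℤ
  weightedSum []       _       = 0ℤ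
  weightedSum (_ ∷ _)  []      = 0ℤ
  weightedSum (a ∷ as) (t ∷ T) = value a * value t + weightedSum as T

  value-Σ⊕ : ∀ as T → value (Σ⊕ (zipWith _⊗_ as T)) ≈ weightedSum as T
  value-Σ⊕ []       _       = mod-≈ 0
  value-Σ⊕ (_ ∷ _)  []      = mod-≈ 0
  value-Σ⊕ (a ∷ as) (t ∷ T) = ≈-trans (value-⊕ (a ⊗ t) (Σ⊕ (zipWith _⊗_ as T)))
    (+-cong (value-⊗ a t) (value-Σ⊕ as T))

  weightedSum-residues : ∀ T w → weightedSum (tabulate (λ i → residue (w i))) T ≈ dot value T w
  weightedSum-residues []      w = ≈-refl
  weightedSum-residues (t ∷ T) w =
    +-cong (*-congʳ (value t) (residue-≈ (w zero))) (weightedSum-residues T (λ i → w (suc i)))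

  ≈⇒≡𝟘 : ∀ {x : ℤ/ n} → value x ≈ 0ℤ → x ≡ 𝟘
  ≈⇒≡𝟘 p = toℕ-injective-≈ (≈-trans p (≈-sym (mod-≈ 0)))

  coprime⇒U : ∀ a → ℕ.Coprime (toℕ a) n → U n a
  coprime⇒U a c = invert (bézout c)
    where
    invert : (∃₂ λ u v → u * value a + v * + n ≡ 1ℤ) → U n a
    invert (u , v , eq) = residue u , to-𝟙 (≈-trans (value-⊗ (residue u) a) ua≈1)
      , to-𝟙 (≈-trans (value-⊗ a (residue u)) (≈-trans (≡⇒≈ (ℤ.*-comm (value a) (value (residue u)))) ua≈1))
      where
      lemma : ∀ x y z → x - (x + y * z) ≡ (- y) * z
      lemma = solve-∀
      ua≈1 : value (residue u) * value a ≈ 1ℤ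
      ua≈1 = ≈-trans (*-congʳ (value a) (residue-≈ u))
        (≈-trans (≈-by-multiple (- v) (+ n) (∣⇒≈0 ℤ.∣-refl) (lemma (u * value a) v (+ n))) (≡⇒≈ eq))
      to-𝟙 : ∀ {x : ℤ/ n} → value x ≈ 1ℤ → x ≡ 𝟙
      to-𝟙 p = toℕ-injective-≈ (≈-trans p (≈-sym (mod-≈ 1)))

  U⇒unit : ∀ {q a} → AdmissiblePrime q → q ℕ.∣ n → U n a → Mod.Unit q (value a)
  U⇒unit {q} {a} (q-prime , 7≤q) q∣n (b , ba≡1 , _) a≈0 = F.unit-1
    (F.≈-trans (congruent-∣ q∣n (≈-trans (≈-sym (≈-trans (≡⇒≈ (cong value ba≡1)) (mod-≈ 1))) (value-⊗ b a)))
      (F.≈-trans (F.*-congˡ (value b) a≈0) (F.≡⇒≈ (ℤ.*-zeroʳ (value b)))))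
    where module F = PrimeField q q-prime 7≤q

  module _ {q} (adm : AdmissiblePrime q) (q∣n : q ℕ.∣ n) where

    private
      module F = PrimeField q (proj₁ adm) (proj₂ adm)
      module C = Counting (vanishesMod? value q)

    weightedSum-zero-terms : ∀ as T → C.#nonzero T ≡ 0 → weightedSum as T F.≈ 0ℤ
    weightedSum-zero-terms []       T       eq = F.≈-refl
    weightedSum-zero-terms (a ∷ as) []      eq = F.≈-refl
    weightedSum-zero-terms (a ∷ as) (t ∷ T) eq = go (vanishesMod? value q t)
      where
      go : Dec (VanishesMod value q t) → value a * value t + weightedSum as T F.≈ 0ℤ
      go (yes z) = F.+-cong (F.≈-trans (F.*-congˡ (value a) z) (F.≡⇒≈ (ℤ.*-zeroʳ (value a))))
        (weightedSum-zero-terms as T (trans (sym (C.#-zero z)) eq))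
      go (no ¬z) = case trans (sym (C.#-nonzero ¬z)) eq of λ ()

    -- Modulo `q` one summand survives, a unit weight times a nonzero term.
    weightedSum-one-nonzero : ∀ as T → length as ≡ length T → All (U n) as → C.#nonzero T ≡ 1 →
      ¬ weightedSum as T F.≈ 0ℤ
    weightedSum-one-nonzero (a ∷ as) (t ∷ T) len (ua ∷ uas) eq sum≈0 = go (vanishesMod? value q t)
      where
      S = weightedSum as T
      go : ¬ Dec (VanishesMod value q t)
      go (yes z) = weightedSum-one-nonzero as T (ℕ.suc-injective len) uas (trans (sym (C.#-zero z)) eq)
        (F.≈-trans (F.≈-sym (F.≈-trans (F.+-cong (F.≈-trans (F.*-congˡ (value a) z) (F.≡⇒≈ (ℤ.*-zeroʳ (value a)))) (F.≈-refl {S}))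
          (F.≡⇒≈ (ℤ.+-identityˡ S)))) sum≈0)
      go (no ¬z) = F.unit-* (U⇒unit adm q∣n ua) ¬z
        (F.≈-trans (F.≈-sym (F.≈-trans (F.+-cong (F.≈-refl {value a * value t}) (weightedSum-zero-terms as T
            (ℕ.suc-injective (trans (sym (C.#-nonzero ¬z)) eq)))) (F.≡⇒≈ (ℤ.+-identityʳ (value a * value t))))) sum≈0)

    zeroSum⇒#≢1 : ∀ T → WeightedZeroSum (U n) T → #nonzeroMod value q T ≢ 1
    zeroSum⇒#≢1 T (_ , as , len , uas , sum≡𝟘) eq = weightedSum-one-nonzero as T len uas eq
      (congruent-∣ q∣n (≈-trans (≈-sym (value-Σ⊕ as T)) (≈-trans (≡⇒≈ (cong value sum≡𝟘)) (mod-≈ 0))))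

  -- The factorisation may list `p` anywhere, and `jacobi` follows its order; the arithmetic works
  -- with `p` moved to the front.
  module _ (p : ℕ) (as bs : List ℕ) (factors≡ : factors (factorise n) ≡ as ++ p ∷ bs)
    (n≡ : n ≡ product (p ∷ as ++ bs)) (coprime : CoprimeFactors (p ∷ as ++ bs))
    (adm : All AdmissiblePrime (p ∷ as ++ bs)) where

    -- With the Legendre factor at `p` pulled out, the remaining product is 1.
    jacobi⇒L : ∀ a → U n a → HasJacobi (as ++ bs) Sign.+ (value a) → L n p a
    jacobi⇒L a ua ja = ua , trans
      (cong (λ fs → foldr _*_ 1ℤ (map (legendre (toℕ a)) fs)) factors≡)
      (trans (foldr-*-middle (legendre (toℕ a)) as p bs)
        (trans (cong (legendre (toℕ a) p *_) (foldr-legendre (as ++ bs) Sign.+ (toℕ a) (All.tail adm) ja))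
          (ℤ.*-identityʳ (legendre (toℕ a) p))))

    hasJacobi⇒units : ∀ qs {s a} → HasJacobi qs s a → All (λ q → Mod.Unit q a) qs
    hasJacobi⇒units []       _                      = []
    hasJacobi⇒units (q ∷ qs) (t , u , st , ju , _) = Mod.hasSign⇒unit q t st ∷ hasJacobi⇒units qs ju

    residue∈L : ∀ w → Mod.Unit p w → HasJacobi (as ++ bs) Sign.+ w → L n p (residue w)
    residue∈L w uw jw = jacobi⇒L (residue w)
      (coprime⇒U (residue w) (subst (ℕ.Coprime (toℕ (residue w))) (sym n≡)
        (coprime-product (p ∷ as ++ bs) (All.map proj₁ adm)
          (All.zipWith (λ {q} (u , c) q∣a → u (Mod.≈-trans q c (Mod.ℕ∣⇒≈0 q q∣a)))
            (uw ∷ hasJacobi⇒units (as ++ bs) jw , All.map (λ {q} → Mod.≈-sym q) residue≈)))))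
      (hasJacobi-≈ (as ++ bs) (All.map (λ {q} → Mod.≈-sym q) (All.tail residue≈)) jw)
      where
      residue≈ : All (λ q → Congruent q (value (residue w)) w) (p ∷ as ++ bs)
      residue≈ = congruent-factors (p ∷ as ++ bs) (congruent-∣ (ℕ.∣-reflexive (sym n≡)) (residue-≈ w))

    solution⇒zeroSum : ∀ T → T ≢ [] → JacobiSolution value p (as ++ bs) T → WeightedZeroSum (L n p) T
    solution⇒zeroSum T T≢[] (w , uw , jw , aw) = T≢[] , tabulate (λ i → residue (w i))
      , length-tabulate _
      , All.tabulate⁺ (λ i → residue∈L (w i) (uw i) (jw i))
      , ≈⇒≡𝟘 (≈-trans (value-Σ⊕ (tabulate (λ i → residue (w i))) T) (≈-trans (weightedSum-residues T w)
          (congruent-∣ (ℕ.∣-reflexive n≡) (congruent-product (p ∷ as ++ bs) coprime aw))))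

-- Segments

infix 4 _⊑_
_⊑_ : {A : Set} → List A → List A → Set
_⊑_ = Infix _≡_

module _ {A : Set} where

  ⊑-refl : ∀ {S : List A} → S ⊑ S
  ⊑-refl = Infix.fromPointwise (Pointwise.refl refl)

  ⊑-trans : ∀ {R S T : List A} → R ⊑ S → S ⊑ T → R ⊑ T
  ⊑-trans = Infix.trans trans

  ⊑-middle : ∀ (X Y : List A) {t T} → T ⊑ X ++ t ∷ Y → T ⊑ X ⊎ T ⊑ Y ⊎ t ∈ T
  ⊑-middle [] Y (here []) = inj₁ (here [])
  ⊑-middle [] Y (here (refl ∷ _)) = inj₂ (inj₂ (here refl))
  ⊑-middle [] Y (there T⊑Y) = inj₂ (inj₁ T⊑Y)
  ⊑-middle (x ∷ X) Y (there T⊑) = [ inj₁ ∘ there , inj₂ ]′ (⊑-middle X Y T⊑)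
  ⊑-middle (x ∷ X) Y (here T⊑) = [ inj₁ ∘ here , inj₂ ∘ inj₂ ]′ (prefix (x ∷ X) T⊑)
    where
    prefix : ∀ X {t T} → Prefix _≡_ T (X ++ t ∷ Y) → Prefix _≡_ T X ⊎ t ∈ T
    prefix []      []         = inj₁ []
    prefix (_ ∷ _) []         = inj₁ []
    prefix []      (refl ∷ _) = inj₂ (here refl)
    prefix (x ∷ X) (x≡ ∷ T⊑)  = [ (λ p → inj₁ (x≡ ∷ p)) , inj₂ ∘ there ]′ (prefix X T⊑)

  ⊑⇒∈ : ∀ {T S : List A} {t} → T ⊑ S → t ∈ T → t ∈ S
  ⊑⇒∈ (there T⊑S) t∈T = there (⊑⇒∈ T⊑S t∈T)
  ⊑⇒∈ (here T⊑S)  t∈T = prefix T⊑S t∈T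
    where
    prefix : ∀ {T S t} → Prefix _≡_ T S → t ∈ T → t ∈ S
    prefix (refl ∷ _) (here refl) = here refl
    prefix (_ ∷ T⊑S) (there t∈T) = there (prefix T⊑S t∈T)

  All-⊑ : ∀ {P : Pred A 0ℓ} {T S} → T ⊑ S → All P S → All P T
  All-⊑ T⊑S ps = All.tabulate (λ t∈T → All.lookup ps (⊑⇒∈ T⊑S t∈T))

module CountingProperties {A : Set} {Z : Pred A 0ℓ} (Z? : Decidable Z) where

  open Counting Z? public

  #-∷-≤ : ∀ t T → #nonzero T ≤ #nonzero (t ∷ T)
  #-∷-≤ t T with Z? t
  ... | yes _ = ℕ.≤-refl
  ... | no _  = ℕ.n≤1+n _

  #-∷-mono : ∀ t {T S} → #nonzero T ≤ #nonzero S → #nonzero (t ∷ T) ≤ #nonzero (t ∷ S)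
  #-∷-mono t le with Z? t
  ... | yes _ = le
  ... | no _  = s≤s le

  #-⊑ : ∀ {T S} → T ⊑ S → #nonzero T ≤ #nonzero S
  #-⊑ (there {b} {bs = S} T⊑S) = ℕ.≤-trans (#-⊑ T⊑S) (#-∷-≤ b S)
  #-⊑ (here T⊑S) = prefix T⊑S
    where
    prefix : ∀ {T S} → Prefix _≡_ T S → #nonzero T ≤ #nonzero S
    prefix []                 = z≤n
    prefix (_∷_ {a} refl T⊑S) = #-∷-mono a (prefix T⊑S)

  all-zero : ∀ {T} → All Z T → #nonzero T ≡ 0
  all-zero []       = refl
  all-zero (z ∷ zs) = trans (#-zero z) (all-zero zs)

  #0⇒all-zero : ∀ T → #nonzero T ≡ 0 → All Z T
  #0⇒all-zero []      _  = []
  #0⇒all-zero (t ∷ T) eq with Z? t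
  ... | yes z = z ∷ #0⇒all-zero T eq

  some-nonzero : ∀ {t T} → t ∈ T → ¬ Z t → 1 ≤ #nonzero T
  some-nonzero {T = t ∷ T} (here refl) ¬z = ℕ.≤-trans (s≤s z≤n) (ℕ.≤-reflexive (sym (#-nonzero {T = T} ¬z)))
  some-nonzero {T = t ∷ T} (there t∈T) ¬z = ℕ.≤-trans (some-nonzero t∈T ¬z) (#-∷-≤ t T)

  some-zero : ∀ T → #nonzero T < length T → ∃ λ t → t ∈ T × Z t
  some-zero (t ∷ T) lt with Z? t
  ... | yes z = t , here refl , z
  ... | no _ with some-zero T (s≤s⁻¹ lt)
  ...   | u , u∈T , z = u , there u∈T , z

  record Isolated (S : List A) : Set where
    constructor isolated
    field
      before   : List A
      term     : A
      after    : List A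
      S≡       : S ≡ before ++ term ∷ after
      nonzero  : ¬ Z term
      zerosˡ   : All Z before
      zerosʳ   : All Z after

  #1⇒isolated : ∀ S → #nonzero S ≡ 1 → Isolated S
  #1⇒isolated (t ∷ S) eq with Z? t
  ... | no ¬z = isolated [] t S refl ¬z [] (#0⇒all-zero S (ℕ.suc-injective eq))
  ... | yes z with #1⇒isolated S eq
  ...   | isolated X u Y S≡ ¬zu zx zy = isolated (t ∷ X) u Y (cong (t ∷_) S≡) ¬zu (z ∷ zx) zy

  isolated-length : ∀ {S} (i : Isolated S) → length S ≡ suc (length (Isolated.before i) ℕ.+ length (Isolated.after i))
  isolated-length (isolated X t Y refl _ _ _) = trans (length-++ X) (ℕ.+-suc (length X) (length Y))

  isolated-⊑ˡ : ∀ {S} (i : Isolated S) → Isolated.before i ⊑ S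
  isolated-⊑ˡ (isolated X t Y refl _ _ _) = ⊑-refl ⁱ++ (t ∷ Y)

  isolated-⊑ʳ : ∀ {S} (i : Isolated S) → Isolated.after i ⊑ S
  isolated-⊑ʳ (isolated X t Y refl _ _ _) = X ++ⁱ there ⊑-refl

  -- Of c + 1 disjoint adjacent pairs one avoids the c nonzero terms.
  adjacent-zeros : ∀ c T → #nonzero T ≤ c → suc c ℕ.* 2 ≤ length T →
    ∃₂ λ t u → t ∷ u ∷ [] ⊑ T × Z t × Z u
  adjacent-zeros c (t ∷ []) _ (s≤s ())
  adjacent-zeros c (t ∷ u ∷ T) few long = go c (Z? t) (Z? u) few long
    where
    skip : ∀ c → suc c ℕ.* 2 ≤ length T → #nonzero T ≤ c → ∃₂ λ x y → x ∷ y ∷ [] ⊑ t ∷ u ∷ T × Z x × Z y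
    skip c long few with adjacent-zeros c T few long
    ... | x , y , xy⊑T , zx , zy = x , y , there (there xy⊑T) , zx , zy
    go : ∀ c → Dec (Z t) → Dec (Z u) → #nonzero (t ∷ u ∷ T) ≤ c → suc c ℕ.* 2 ≤ suc (suc (length T)) →
      ∃₂ λ x y → x ∷ y ∷ [] ⊑ t ∷ u ∷ T × Z x × Z y
    go c (yes zt) (yes zu) _ _ = t , u , here (refl ∷ refl ∷ []) , zt , zu
    go 0 (no ¬zt) _ few _ = contradiction (ℕ.≤-trans (ℕ.≤-reflexive (sym (#-nonzero {T = u ∷ T} ¬zt))) few) λ ()
    go 0 (yes _) (no ¬zu) few _ =
      contradiction (ℕ.≤-trans (ℕ.≤-trans (ℕ.≤-reflexive (sym (#-nonzero {T = T} ¬zu))) (#-∷-≤ t (u ∷ T))) few) λ ()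
    go (suc c) (no ¬zt) _ few long = skip c (s≤s⁻¹ (s≤s⁻¹ long))
      (ℕ.≤-trans (#-∷-≤ u T) (s≤s⁻¹ (ℕ.≤-trans (ℕ.≤-reflexive (sym (#-nonzero {T = u ∷ T} ¬zt))) few)))
    go (suc c) (yes zt) (no ¬zu) few long = skip c (s≤s⁻¹ (s≤s⁻¹ long))
      (s≤s⁻¹ (ℕ.≤-trans (ℕ.≤-reflexive (sym (#-nonzero {T = T} ¬zu))) (ℕ.≤-trans (#-∷-≤ t (u ∷ T)) few)))

-- Good segments and exceptional segments

module Segments {A : Set} {Z : ℕ → Pred A 0ℓ} (Z? : ∀ q → Decidable (Z q)) where

  module C q = CountingProperties (Z? q)

  # : ℕ → List A → ℕ
  # q = C.#nonzero q

  Good : List ℕ → List A → Set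
  Good qs T = All (λ q → # q T ≢ 1) qs

  half : ∀ {m} x y → m ℕ.+ m ≤ suc (x ℕ.+ y) → m ≤ x ⊎ m ≤ y
  half {m} x y le with m ℕ.≤? x | m ℕ.≤? y
  ... | yes m≤x | _       = inj₁ m≤x
  ... | no _    | yes m≤y = inj₂ m≤y
  ... | no m≰x  | no m≰y  = contradiction (ℕ.≤-trans (ℕ.+-mono-≤ (ℕ.≰⇒> m≰x) (ℕ.≰⇒> m≰y)) le)
        (ℕ.<⇒≱ (s≤s (ℕ.≤-reflexive (sym (ℕ.+-suc x y)))))

  2^1+ : ∀ k → 2 ^ suc k ≡ 2 ^ k ℕ.+ 2 ^ k
  2^1+ k = cong (2 ^ k ℕ.+_) (ℕ.+-identityʳ (2 ^ k))

  nonempty : ∀ {S : List A} → 1 ≤ length S → S ≢ []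
  nonempty {[]} ()
  nonempty {_ ∷ _} _ ()

  -- If q spoils S, then S has a single term nonzero mod q, and q can be
  -- discarded on the longer side of that term.
  good-segment : ∀ k qs S → length qs ≡ k → 2 ^ k ≤ length S → ∃ λ T → T ⊑ S × T ≢ [] × Good qs T
  good-segment 0 [] S _ len = S , ⊑-refl , nonempty len , []
  good-segment (suc k) qs S |qs| len with any? (λ q → # q S ℕ.≟ 1) qs
  ... | no none = S , ⊑-refl , nonempty (ℕ.≤-trans (ℕ.m^n>0 2 (suc k)) len) , All.¬Any⇒All¬ qs none
  ... | yes some with find some
  ...   | q , q∈qs , #1 with ∈-∃++ q∈qs
  ...     | as , bs , refl = choose (half (length X) (length Y) (subst (2 ^ k ℕ.+ 2 ^ k ≤_) (C.isolated-length q i)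
              (ℕ.≤-trans (ℕ.≤-reflexive (sym (2^1+ k))) len)))
    where
    i = C.#1⇒isolated q S #1
    X = C.Isolated.before i
    Y = C.Isolated.after i
    |as++bs| : length (as ++ bs) ≡ k
    |as++bs| = ℕ.suc-injective (trans (cong suc (length-++ as)) (trans (sym (ℕ.+-suc (length as) (length bs)))
      (trans (sym (length-++ as)) |qs|)))
    -- Every term of `W` vanishes modulo `q`, so the count at `q` is 0 on all segments of `W` and
    -- `q` cannot spoil them.
    restore : ∀ {W} → W ⊑ S → All (Z q) W → (∃ λ T → T ⊑ W × T ≢ [] × Good (as ++ bs) T) →
      ∃ λ T → T ⊑ S × T ≢ [] × Good (as ++ q ∷ bs) T
    restore W⊑S zeros (T , T⊑W , T≢[] , good) = T , ⊑-trans T⊑W W⊑S , T≢[]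
      , All.++⁺ (All.++⁻ˡ as good)
          ((λ #≡1 → contradiction (trans (sym (C.all-zero q (All-⊑ T⊑W zeros))) #≡1) λ ()) ∷ All.++⁻ʳ as good)
    choose : 2 ^ k ≤ length X ⊎ 2 ^ k ≤ length Y → ∃ λ T → T ⊑ S × T ≢ [] × Good (as ++ q ∷ bs) T
    choose (inj₁ len) = restore (C.isolated-⊑ˡ q i) (C.Isolated.zerosˡ i) (good-segment k (as ++ bs) X |as++bs| len)
    choose (inj₂ len) = restore (C.isolated-⊑ʳ q i) (C.Isolated.zerosʳ i) (good-segment k (as ++ bs) Y |as++bs| len)

  -- `H` stands for having a consecutive `L n p`-weighted zero-sum. From here on only its
  -- monotonicity and the dichotomy matter, and the argument is pure counting.
  module _ {p q₀ : ℕ} {qs : List ℕ} (q₀∈qs : q₀ ∈ qs) {H : List A → Set}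
    (H-⊑ : ∀ {T S} → T ⊑ S → H T → H S)
    (dichotomy : ∀ T → T ≢ [] → Good (p ∷ qs) T → H T ⊎
      (All (λ q → # q T ≡ 2) qs ×
       (∀ {q q′ t} → q ∈ qs → q′ ∈ qs → t ∈ T → Z q t → Z q′ t))) where

    TwoEach : List A → Set
    TwoEach T = All (λ q → # q T ≡ 2) qs

    -- The exceptional case would need two nonzero terms modulo `q₀`.
    all-vanishing : ∀ T → T ≢ [] → # p T ≢ 1 → All (λ q → # q T ≡ 0) qs → H T
    all-vanishing T T≢[] p-good zeros =
      case dichotomy T T≢[] (p-good ∷ All.map (λ ≡0 ≡1 → case trans (sym ≡0) ≡1 of λ ()) zeros) of λ where
        (inj₁ h) → h
        (inj₂ (two , _)) → case trans (sym (All.lookup zeros q₀∈qs)) (All.lookup two q₀∈qs) of λ ()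

    zero-term : ∀ t → Z p t → All (λ q → Z q t) qs → H (t ∷ [])
    zero-term t zp zs = all-vanishing (t ∷ []) (λ ())
      (λ ≡1 → case trans (sym (C.all-zero p (zp ∷ []))) ≡1 of λ ())
      (All.map (λ {q} z → C.all-zero q (z ∷ [])) zs)

    -- Either one of the terms vanishes modulo `p` too and suffices by itself, or both survive
    -- modulo `p` and the count there is 2.
    zero-pair : ∀ t u → All (λ q → Z q t) qs → All (λ q → Z q u) qs → H (t ∷ u ∷ [])
    zero-pair t u zt zu with Z? p t | Z? p u
    ... | yes z | _     = H-⊑ (here (refl ∷ [])) (zero-term t z zt)
    ... | no _  | yes z = H-⊑ (there (here (refl ∷ []))) (zero-term u z zu)
    ... | no ¬t | no ¬u = all-vanishing (t ∷ u ∷ []) (λ ())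
          (λ ≡1 → case trans (sym (trans (C.#-nonzero p ¬t) (cong suc (C.#-nonzero p ¬u)))) ≡1 of λ ())
          (All.zipWith (λ {q} (a , b) → C.all-zero q (a ∷ b ∷ [])) (zt , zu))

    -- If `T` is exceptional, its two nonzero terms cannot meet all three disjoint adjacent pairs in
    -- six terms; a pair that they miss vanishes modulo every prime of `qs`.
    good-long : ∀ T → Good (p ∷ qs) T → 6 ≤ length T → H T
    good-long T good long with dichotomy T (nonempty (ℕ.≤-trans (s≤s z≤n) long)) good
    ... | inj₁ h = h
    ... | inj₂ (two , shared) with C.adjacent-zeros q₀ 2 T (ℕ.≤-reflexive (All.lookup two q₀∈qs)) long
    ...   | t , u , tu⊑T , zt , zu = H-⊑ tu⊑T (zero-pair t u
            (All.tabulate λ q∈ → shared q₀∈qs q∈ (⊑⇒∈ tu⊑T (here refl)) zt)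
            (All.tabulate λ q∈ → shared q₀∈qs q∈ (⊑⇒∈ tu⊑T (there (here refl))) zu))

    -- If `T` is exceptional, a third term vanishes modulo all of `qs`, and it vanishes modulo `p`
    -- by hypothesis.
    good-vanishing : ∀ T → All (Z p) T → Good qs T → 3 ≤ length T → H T
    good-vanishing T zp good long
      with dichotomy T (nonempty (ℕ.≤-trans (s≤s z≤n) long)) ((λ ≡1 → case trans (sym (C.all-zero p zp)) ≡1 of λ ()) ∷ good)
    ... | inj₁ h = h
    ... | inj₂ (two , shared) with C.some-zero q₀ T (ℕ.≤-trans (ℕ.≤-reflexive (cong suc (All.lookup two q₀∈qs))) long)
    ...   | t , t∈T , zt = H-⊑ (∈⇒⊑ t∈T) (zero-term t (All.lookup zp t∈T)
            (All.tabulate λ q∈ → shared q₀∈qs q∈ t∈T zt))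
      where
      ∈⇒⊑ : ∀ {t} {T : List A} → t ∈ T → t ∷ [] ⊑ T
      ∈⇒⊑ (here refl) = here (refl ∷ [])
      ∈⇒⊑ (there t∈T) = there (∈⇒⊑ t∈T)

    -- Counts are monotone in the segment, so a count of two cannot drop to one.
    two-each⇒good : ∀ {T S} → T ⊑ S → TwoEach T → Good qs S
    two-each⇒good T⊑S = All.map λ {q} ≡2 ≡1 →
      case ℕ.≤-trans (ℕ.≤-reflexive (sym ≡2)) (ℕ.≤-trans (C.#-⊑ q T⊑S) (ℕ.≤-reflexive ≡1)) of λ { (s≤s ()) }

    module _ (qs-long : 2 ≤ length qs) where

      4≤2^ : 4 ≤ 2 ^ length qs
      4≤2^ = ℕ.^-monoʳ-≤ 2 qs-long

      -- `T` makes `X` good, so three terms in `X` suffice. Otherwise `Y` has at least 2 ^ length qs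
      -- terms and contains a good segment; if that one is exceptional, it makes the long `Y` good
      -- in turn.
      vanishing-sides : ∀ T X Y → T ⊑ X → TwoEach T → All (Z p) X → All (Z p) Y →
        2 ^ suc (length qs) ≤ suc (suc (length X ℕ.+ length Y)) → H X ⊎ H Y
      vanishing-sides T X Y T⊑X two zX zY len with 3 ℕ.≤? length X
      ... | yes long = inj₁ (good-vanishing X zX (two-each⇒good T⊑X two) long)
      ... | no short = inj₂ (second (good-segment (length qs) qs Y refl 2^≤|Y|))
        where
        2^≤|Y| : 2 ^ length qs ≤ length Y
        2^≤|Y| = ℕ.+-cancelˡ-≤ 4 _ _ (begin
          4 ℕ.+ 2 ^ length qs                 ≤⟨ ℕ.+-monoˡ-≤ (2 ^ length qs) 4≤2^ ⟩
          2 ^ length qs ℕ.+ 2 ^ length qs     ≡⟨ 2^1+ (length qs) ⟨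
          2 ^ suc (length qs)               ≤⟨ len ⟩
          2 ℕ.+ (length X ℕ.+ length Y)         ≤⟨ ℕ.+-monoʳ-≤ 2 (ℕ.+-monoˡ-≤ (length Y) (s≤s⁻¹ (ℕ.≰⇒> short))) ⟩
          4 ℕ.+ length Y                      ∎)
          where open ℕ.≤-Reasoning
        second : (∃ λ T → T ⊑ Y × T ≢ [] × Good qs T) → H Y
        second (T , T⊑Y , T≢[] , good) with dichotomy T T≢[]
          ((λ ≡1 → case trans (sym (C.all-zero p (All-⊑ T⊑Y zY))) ≡1 of λ ()) ∷ good)
        ... | inj₁ h = H-⊑ T⊑Y h
        ... | inj₂ (two , _) = good-vanishing Y zY (two-each⇒good T⊑Y two)
              (ℕ.≤-trans (ℕ.≤-trans (ℕ.n≤1+n 3) 4≤2^) 2^≤|Y|)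

      -- An exceptional `T` leaves `p` as the only prime that can spoil `S`. If `p` does not,
      -- `good-long` applies, as `S` has at least 2³ - 1 = 7 terms. If it does, `S` is cut at its
      -- only term nonzero modulo `p`.
      good-segment⇒H : ∀ S T → 2 ^ suc (length qs) ≤ suc (length S) → T ⊑ S → T ≢ [] → Good (p ∷ qs) T → H S
      good-segment⇒H S T len T⊑S T≢[] good with dichotomy T T≢[] good
      ... | inj₁ h = H-⊑ T⊑S h
      ... | inj₂ (two , _) with # p S ℕ.≟ 1
      ...   | no ≢1 = good-long S (≢1 ∷ two-each⇒good T⊑S two) 6≤|S|
        where
        6≤|S| : 6 ≤ length S
        6≤|S| = s≤s⁻¹ (ℕ.≤-trans (ℕ.≤-trans (ℕ.n≤1+n 7) (ℕ.^-monoʳ-≤ 2 (s≤s qs-long))) len)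
      ...   | yes #1 = locate (⊑-middle X Y (subst (T ⊑_) (C.Isolated.S≡ i) T⊑S))
        where
        i = C.#1⇒isolated p S #1
        X = C.Isolated.before i
        Y = C.Isolated.after i
        X⊑S = C.isolated-⊑ˡ p i
        Y⊑S = C.isolated-⊑ʳ p i
        zX = C.Isolated.zerosˡ i
        zY = C.Isolated.zerosʳ i
        len′ : 2 ^ suc (length qs) ≤ suc (suc (length X ℕ.+ length Y))
        len′ = ℕ.≤-trans len (s≤s (ℕ.≤-reflexive (C.isolated-length p i)))
        locate : T ⊑ X ⊎ T ⊑ Y ⊎ C.Isolated.term i ∈ T → H S
        locate (inj₁ T⊑X) = [ H-⊑ X⊑S , H-⊑ Y⊑S ]′ (vanishing-sides T X Y T⊑X two zX zY len′)
        locate (inj₂ (inj₁ T⊑Y)) = [ H-⊑ Y⊑S , H-⊑ X⊑S ]′ (vanishing-sides T Y X T⊑Y two zY zX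
          (ℕ.≤-trans len′ (s≤s (s≤s (ℕ.≤-reflexive (ℕ.+-comm (length X) (length Y)))))))
        -- A segment through the only term nonzero modulo `p` has count 1 there, so it is not good.
        locate (inj₂ (inj₂ t∈T)) = contradiction
          (ℕ.≤-antisym (ℕ.≤-trans (C.#-⊑ p T⊑S) (ℕ.≤-reflexive #1)) (C.some-nonzero p t∈T (C.Isolated.nonzero i)))
          (All.head good)

  -- A long sequence without good segments

  module _ (f : ℕ → A) where

    -- Terms are arranged like the marks on a ruler: starting from c = 1, the middle term comes from
    -- 1, the middles of the halves from q₁, those of the quarters from q₁q₂, and so on. On each
    -- level one further prime divides all terms but the central one.
    ruler : ℕ → List ℕ → List A
    ruler c []       = []
    ruler c (q ∷ qs) = ruler (c ℕ.* q) qs ++ f c ∷ ruler (c ℕ.* q) qs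

    length-ruler : ∀ c qs → suc (length (ruler c qs)) ≡ 2 ^ length qs
    length-ruler c []       = refl
    length-ruler c (q ∷ qs) = begin
      suc (length (R ++ f c ∷ R))         ≡⟨ cong suc (length-++ R) ⟩
      suc (length R) ℕ.+ suc (length R)     ≡⟨ cong₂ ℕ._+_ (length-ruler (c ℕ.* q) qs) (length-ruler (c ℕ.* q) qs) ⟩
      2 ^ length qs ℕ.+ 2 ^ length qs       ≡⟨ 2^1+ (length qs) ⟨
      2 ^ suc (length qs)                 ∎
      where
      open ≡-Reasoning
      R = ruler (c ℕ.* q) qs

    ruler-vanishes : ∀ {q} → (∀ c → q ∣ c → Z q (f c)) → ∀ c qs → q ∣ c → All (Z q) (ruler c qs)
    ruler-vanishes z c []        q∣c = []
    ruler-vanishes z c (q′ ∷ qs) q∣c = All.++⁺ zs (z c q∣c ∷ zs)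
      where zs = ruler-vanishes z (c ℕ.* q′) qs (ℕ.∣m⇒∣m*n q′ q∣c)

    -- T either contains the central term f c, the only one not vanishing mod q, or
    -- lies on one side of it.
    ruler-bad : ∀ c qs → All Prime qs → CoprimeFactors qs → All (λ q → ¬ q ∣ c) qs →
      (∀ {q} → q ∈ qs → ∀ d → q ∣ d → Z q (f d)) → (∀ {q} → q ∈ qs → ∀ d → Z q (f d) → q ∣ d) →
      ∀ {T} → T ⊑ ruler c qs → T ≢ [] → ∃ λ q → q ∈ qs × # q T ≡ 1
    ruler-bad c []       _        _            _            _   _   (here []) T≢[] = contradiction refl T≢[]
    ruler-bad c (q ∷ qs) (pr ∷ prs) (co , cos) (q∤c ∷ qs∤c) ∣⇒Z Z⇒∣ {T} T⊑ T≢[] =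
      [ inner , [ inner , centre ]′ ]′ (⊑-middle R R T⊑)
      where
      R = ruler (c ℕ.* q) qs
      zeros : All (Z q) R
      zeros = ruler-vanishes (∣⇒Z (here refl)) (c ℕ.* q) qs (ℕ.∣n⇒∣m*n c ℕ.∣-refl)
      inner : T ⊑ R → ∃ λ q′ → q′ ∈ q ∷ qs × # q′ T ≡ 1
      inner T⊑R with ruler-bad (c ℕ.* q) qs prs cos (prime∤* pr prs co qs∤c) (λ q∈ → ∣⇒Z (there q∈)) (λ q∈ → Z⇒∣ (there q∈)) T⊑R T≢[]
      ... | q′ , q′∈qs , eq = q′ , there q′∈qs , eq
      centre : f c ∈ T → ∃ λ q′ → q′ ∈ q ∷ qs × # q′ T ≡ 1
      centre c∈T = q , here refl , ℕ.≤-antisym (ℕ.≤-trans (C.#-⊑ q T⊑) (ℕ.≤-reflexive total)) (C.some-nonzero q c∈T ¬Zc)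
        where
        ¬Zc : ¬ Z q (f c)
        ¬Zc = q∤c ∘ Z⇒∣ (here refl) c
        count-++ : ∀ {X} Y → All (Z q) X → # q (X ++ Y) ≡ # q Y
        count-++ Y []       = refl
        count-++ Y (z ∷ zs) = trans (C.#-zero q z) (count-++ Y zs)
        total : # q (R ++ f c ∷ R) ≡ 1
        total = trans (count-++ (f c ∷ R) zeros) (trans (C.#-nonzero q ¬Zc) (cong suc (C.all-zero q zeros)))

-- Comparison of L(n;p) and U(n)

squareFree⇒coprimeFactors : ∀ qs → All Prime qs → SquareFree (product qs) → CoprimeFactors qs
squareFree⇒coprimeFactors []       _          _  = _
squareFree⇒coprimeFactors (q ∷ qs) (pr ∷ prs) sf = coprime , squareFree⇒coprimeFactors qs prs
  λ d d²∣ → sf d (ℕ.∣-trans d²∣ (ℕ.n∣m*n q {product qs}))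
  where
  coprime : ℕ.Coprime q (product qs)
  coprime (e∣q , e∣qs) with prime⇒irreducible pr e∣q
  ... | inj₁ e≡1  = e≡1
  ... | inj₂ refl = sf q (ℕ.*-monoʳ-∣ q e∣qs)

module _ (n : ℕ) .{{_ : NonZero n}} (p : ℕ) (as bs : List ℕ)
  (factors≡ : factors (factorise n) ≡ as ++ p ∷ bs) (n≡ : n ≡ product (p ∷ as ++ bs))
  (coprime : CoprimeFactors (p ∷ as ++ bs)) (adm : All AdmissiblePrime (p ∷ as ++ bs)) where

  open Residues n

  private
    qs ps : List ℕ
    qs = as ++ bs
    ps = p ∷ qs
    HasL = HasConsecutiveZeroSum (L n p)
    HasU = HasConsecutiveZeroSum (U n)

  open Segments (vanishesMod? value)

  divides-n : All (_∣ n) ps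
  divides-n = All.tabulate λ q∈ → subst (_ ∣_) (sym n≡) (∈⇒∣product q∈)

  ℕ-mod : ℕ → ℤ/ n
  ℕ-mod c = c mod n

  reduce : ∀ {q} → q ∈ ps → ∀ d → Congruent q (value (ℕ-mod d)) (+ d)
  reduce q∈ d = congruent-∣ (All.lookup divides-n q∈) (Mod.mod-≈ n d)

  has-⊑ : ∀ {A T S} → T ⊑ S → HasConsecutiveZeroSum {n} A T → HasConsecutiveZeroSum A S
  has-⊑ T⊑S (R , R⊑T , zs) = R , ⊑-trans R⊑T T⊑S , zs

  hasL⇒hasU : ∀ {S} → HasL S → HasU S
  hasL⇒hasU (T , T⊑S , T≢[] , as , len , as∈L , sum) = T , T⊑S , T≢[] , as , len , All.map proj₁ as∈L , sum

  zeroSum⇒good : ∀ T → WeightedZeroSum (U n) T → Good ps T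
  zeroSum⇒good T zs = All.zipWith (λ (a , q∣n) → zeroSum⇒#≢1 a q∣n T zs) (adm , divides-n)

  dichotomy : ∀ rs → 1 ≤ length rs → CoprimeFactors (p ∷ rs) → All AdmissiblePrime (p ∷ rs) →
    ∀ T → Good (p ∷ rs) T → JacobiSolution value p rs T ⊎ SharedPair value rs T
  dichotomy (r ∷ rs) _ cs adms T good = jacobi-solution value p r rs T adms cs good

  -- If `p` is the only prime, the Jacobi symbol is the Legendre symbol at `p`.
  U⊆L : length qs ≡ 0 → ∀ {a} → U n a → L n p a
  U⊆L |qs|≡0 {a} ua = jacobi⇒L p as bs factors≡ n≡ coprime adm a ua (trivial qs |qs|≡0)
    where
    trivial : ∀ rs → length rs ≡ 0 → HasJacobi rs Sign.+ (value a)
    trivial [] _ = refl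

  good⇒hasL : 2 ≤ length qs → ∀ S T → 2 ^ length ps ≤ suc (length S) → T ⊑ S → T ≢ [] → Good ps T → HasL S
  good⇒hasL 2≤ = good-segment⇒H (proj₂ (member qs 1≤)) has-⊑
    (λ T T≢[] good → Sum.map₁ (λ sol → T , ⊑-refl , solution⇒zeroSum p as bs factors≡ n≡ coprime adm T T≢[] sol)
      (dichotomy qs 1≤ coprime adm T good))
    2≤
    where
    1≤ : 1 ≤ length qs
    1≤ = ℕ.≤-trans (ℕ.n≤1+n 1) 2≤
    member : ∀ (rs : List ℕ) → 1 ≤ length rs → ∃ λ r → r ∈ rs
    member (r ∷ _) _ = r , here refl

  -- The length bound matters: in a short sequence every good segment may be exceptional. The bound
  -- is 2^Ω(n) - 1, the length that an extremal sequence has at least.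
  hasU⇒hasL : length qs ≢ 1 → ∀ S → 2 ^ length ps ≤ suc (length S) → HasU S → HasL S
  hasU⇒hasL |qs|≢1 S len (T , T⊑S , zs@(T≢[] , weights , |weights| , weights∈U , sum)) =
    by-length (length qs) refl
    where
    by-length : ∀ k → length qs ≡ k → HasL S
    by-length 0 eq = T , T⊑S , T≢[] , weights , |weights| , All.map (λ {a} → U⊆L eq {a}) weights∈U , sum
    by-length 1 eq = contradiction eq |qs|≢1
    by-length (suc (suc k)) eq =
      good⇒hasL (ℕ.≤-trans (s≤s (s≤s z≤n)) (ℕ.≤-reflexive (sym eq))) S T len T⊑S T≢[] (zeroSum⇒good T zs)

  ruler-not-hasU : ¬ HasU (ruler ℕ-mod 1 ps)
  ruler-not-hasU (T , T⊑R , zs) = refute (ruler-bad ℕ-mod 1 ps (All.map proj₁ adm) coprime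
      (All.map (λ {q} (pr , _) q∣1 → ¬prime[1] (subst Prime (ℕ.∣1⇒≡1 q∣1) pr)) adm)
      (λ {q} q∈ d q∣d → Mod.≈-trans q (reduce q∈ d) (Mod.ℕ∣⇒≈0 q q∣d))
      (λ {q} q∈ d z → Mod.≈0⇒ℕ∣ q (Mod.≈-trans q (Mod.≈-sym q (reduce q∈ d)) z))
      T⊑R (proj₁ zs))
    where
    refute : ¬ (∃ λ q → q ∈ ps × # q T ≡ 1)
    refute (q , q∈ps , #1) = All.lookup (zeroSum⇒good T zs) q∈ps #1

  -- A smaller `j` is refuted by a prefix of the ruler sequence, which has 2^Ω(n) - 1 terms.
  everyU⇒2^≤ : ∀ j → EveryHasConsecutiveZeroSum (U n) j → 2 ^ length ps ≤ j
  everyU⇒2^≤ j every = ℕ.≮⇒≥ λ j<2^ → ruler-not-hasU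
    (has-⊑ (take-⊑ j R) (every (take j R) (trans (length-take j R)
      (ℕ.m≤n⇒m⊓n≡m (s≤s⁻¹ (ℕ.≤-trans j<2^ (ℕ.≤-reflexive (sym (length-ruler ℕ-mod 1 ps)))))))))
    where
    R = ruler ℕ-mod 1 ps
    take-⊑ : ∀ j (S : List (ℤ/ n)) → take j S ⊑ S
    take-⊑ j S = here (prefix j S)
      where
      prefix : ∀ j (S : List (ℤ/ n)) → Prefix _≡_ (take j S) S
      prefix zero    S       = []
      prefix (suc j) []      = []
      prefix (suc j) (x ∷ S) = refl ∷ prefix j S

  -- The constants are compared without being evaluated. A length that works for `U n` is at least
  -- 2^Ω(n), where `hasU⇒hasL` applies, so the same lengths work for both weight sets.
  cExtremal-L⇔U : length qs ≢ 1 → ∀ S → CExtremal (L n p) S ⇔ CExtremal (U n) S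
  cExtremal-L⇔U |qs|≢1 S = mk⇔
    (λ ((pos , every , least) , ¬has) →
      let everyU = λ R |R| → hasL⇒hasU (every R |R|) in
      (pos , everyU , λ j 0<j every′ → least j 0<j (everyU⇒everyL every′))
      -- Here `suc (length S)` is itself a length that works for `U n`, so `S` falls short of 2^Ω(n)
      -- by at most one, just as `hasU⇒hasL` allows.
      , λ has → ¬has (hasU⇒hasL |qs|≢1 S (everyU⇒2^≤ (suc (length S)) everyU) has))
    (λ ((pos , every , least) , ¬has) →
      (pos , everyU⇒everyL every , λ j 0<j every′ → least j 0<j (λ R |R| → hasL⇒hasU (every′ R |R|)))
      , λ has → ¬has (hasL⇒hasU has))
    where
    everyU⇒everyL : ∀ {j} → EveryHasConsecutiveZeroSum (U n) j → EveryHasConsecutiveZeroSum (L n p) j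
    everyU⇒everyL {j} every R |R| = hasU⇒hasL |qs|≢1 R
      (ℕ.≤-trans (everyU⇒2^≤ j every) (ℕ.≤-trans (ℕ.≤-reflexive (sym |R|)) (ℕ.n≤1+n (length R)))) (every R |R|)

theorem7p2 : (n : ℕ) .{{_ : NonZero n}} →
    SquareFree n →
    (∀ p → Prime p → p ∣ n → 7 ≤ p) →
    (p′ : ℕ) → Prime p′ → p′ ∣ n →
    Ω n ≢ 2 →
    (S : List (ℤ/ n)) → CExtremal (L n p′) S ⇔ CExtremal (U n) S
theorem7p2 n squareFree 7≤ p p-prime p∣n Ω≢2 = by-factors (∈-∃++ p∈fs)
  where
  fs = factors (factorise n)
  n≡fs = PrimeFactorisation.isFactorisation (factorise n)
  fs-prime = PrimeFactorisation.factorsPrime (factorise n)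
  p∈fs : p ∈ fs
  p∈fs = factorisationHasAllPrimeFactors p-prime (subst (p ∣_) n≡fs p∣n) fs-prime
  by-factors : (∃ λ as → ∃ λ bs → fs ≡ as ++ p ∷ bs) → ∀ S → CExtremal (L n p) S ⇔ CExtremal (U n) S
  by-factors (as , bs , fs≡) = cExtremal-L⇔U n p as bs fs≡ n≡ps
      (squareFree⇒coprimeFactors ps ps-prime (subst SquareFree n≡ps squareFree))
      (All.tabulate λ q∈ → All.lookup ps-prime q∈ , 7≤ _ (All.lookup ps-prime q∈) (subst (_ ∣_) (sym n≡ps) (∈⇒∣product q∈)))
      (λ |qs|≡1 → Ω≢2 (trans (↭-length fs↭ps) (cong suc |qs|≡1)))
    where
    ps = p ∷ as ++ bs
    fs↭ps : fs ↭ ps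
    fs↭ps = subst (_↭ ps) (sym fs≡) (shift p as bs)
    n≡ps : n ≡ product ps
    n≡ps = trans n≡fs (product-↭ fs↭ps)
    ps-prime : All Prime ps
    ps-prime = All-resp-↭ fs↭ps fs-prime
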